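{- Taking suprema over all edge probability measures $\mu$ (on all finite complete graphs), \[ \sup_{\mu}\Bigl(2\sum_{e\in\operatorname{supp}\mu}\mu(e)^2+\beta(\mu;P_3)\Bigr)=2, \] \[ \sup_{\mu}\bigl(2m\cdot\beta(\mu;C_m)+\beta(\mu;P_{m+1})\bigr)=\frac{2}{m^{m-1}}\quad\text{for } m\in\{3,4\}, \] \[ \sup_{\mu}\bigl(2m\cdot\beta(\mu;C_m)+\beta(\mu;P_{m+1})\bigr)<\frac{2.7}{m^{m-1}}\quad\text{for all integers } m\ge 5. \]
   Context: $C_k$ is the cycle on $k$ vertices and $P_k$ is the path on $k$ vertices. An edge probability measure is a probability measure $\mu$ on the edge set of some finite complete graph $K$; $\operatorname{supp}\mu$ is the set of edges of positive mass. For a subgraph $H'\subseteq K$, $\mu(H')=\prod_{e\in E(H')}\mu(e)$, and for a graph $H$, $\beta(\mu;H)=\sum_{H'}\mu(H')$, the sum over all (unlabeled, not necessarily induced) subgraphs $H'$ of $K$ isomorphic to $H$.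
   Formalization: The edge probability measures μ are taken with rational masses only, instead of real ones; since the quantities are polynomials in the masses, the suprema over real measures are the same by density and continuity. -}

module Defs where

open import Data.Nat as ℕ using (ℕ; zero; suc)
open import Data.Nat.Properties using (m^n≢0; m*n≢0)
open import Data.Fin as Fin using (Fin; zero; suc; splitAt; fromℕ; inject₁)
open import Data.Fin.Properties as FinP using (any?; all?)
open import Data.Vec using (Vec; []; _∷_; lookup)
open import Data.Bool using (Bool; true; false)
open import Data.Bool.Properties using () renaming (_≟_ to _≟B_)
open import Data.Integer using (+_)
open import Data.Rational using (ℚ; 0ℚ; 1ℚ; _+_; _*_; _-_; _≤_; _<_; _/_)
open import Data.Rational.Properties using (_<?_)
open import Data.Product using (Σ; ∃; _×_; _,_; proj₁; proj₂)
open import Data.Sum using (_⊎_; inj₁; inj₂)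
open import Relation.Binary.PropositionalEquality using (_≡_)
open import Relation.Nullary using (Dec; yes; no; ¬_)
open import Relation.Nullary.Decidable using (_×-dec_; _→-dec_; _⊎-dec_)

ΣFin : (k : ℕ) → (Fin k → ℚ) → ℚ
ΣFin zero    f = 0ℚ
ΣFin (suc k) f = f zero + ΣFin k (λ i → f (suc i))

ΠFin : (k : ℕ) → (Fin k → ℚ) → ℚ
ΠFin zero    f = 1ℚ
ΠFin (suc k) f = f zero * ΠFin k (λ i → f (suc i))

𝟙 : ∀ {a} {A : Set a} → Dec A → ℚ → ℚ
𝟙 (yes _) q = q
𝟙 (no  _) q = 0ℚ

-- The complete graph K_n on vertex set Fin n.
-- Its edges are enumerated by Fin (nEdges n); edge e has endpoints
-- ends n e = (x , y) with x < y.  (Vertex 0 is the "new" vertex.)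

nEdges : ℕ → ℕ
nEdges zero    = zero
nEdges (suc n) = n ℕ.+ nEdges n

ends : (n : ℕ) → Fin (nEdges n) → Fin n × Fin n
ends (suc n) e with splitAt n e
... | inj₁ i  = zero , suc i
... | inj₂ e′ = suc (proj₁ (ends n e′)) , suc (proj₂ (ends n e′))

Edge : ℕ → Set
Edge n = Fin (nEdges n)

record EdgeProb (n : ℕ) : Set where
  field
    μ      : Edge n → ℚ
    nonneg : ∀ e → 0ℚ ≤ μ e
    total  : ΣFin (nEdges n) μ ≡ 1ℚ
open EdgeProb public

record Graph : Set where
  field
    verts : ℕ
    nE    : ℕ
    edge  : Fin nE → Fin verts × Fin verts
open Graph public

Path : ℕ → Graph
Path zero    = record { verts = zero ; nE = zero ; edge = λ () }
Path (suc k) = record { verts = suc k ; nE = k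
                      ; edge = λ i → inject₁ i , suc i }

-- cycle C_{k+1} on k+1 vertices: edges {i , i+1} and {k , 0}
-- (a genuine cycle when k+1 ≥ 3; only used in that case)
cycEdge : (k : ℕ) → Fin (suc k) → Fin (suc k) × Fin (suc k)
cycEdge k zero    = fromℕ k , zero
cycEdge k (suc i) = inject₁ i , suc i

Cycle : ℕ → Graph
Cycle zero    = record { verts = zero ; nE = zero ; edge = λ () }
Cycle (suc k) = record { verts = suc k ; nE = suc k ; edge = cycEdge k }

-- Subgraphs of K_n isomorphic to H.
-- A subgraph of K_n is given by its edge set S ⊆ E(K_n) (a Vec Bool).
-- Since the pattern graphs used (paths, cycles) have no isolated
-- vertices, a subgraph isomorphic to H is determined by its edge set,
-- and S is (the edge set of) such a copy iff S is the image of E(H)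
-- under some injective vertex map f : V(H) → V(K_n).

Injective : ∀ {n k} → Vec (Fin n) k → Set
Injective {n} {k} f = ∀ i j → lookup f i ≡ lookup f j → i ≡ j

Hits : ∀ {n} (H : Graph) → Vec (Fin n) (verts H) → Fin (nE H) → Edge n → Set
Hits {n} H f h e =
  (lookup f a ≡ x × lookup f b ≡ y) ⊎ (lookup f a ≡ y × lookup f b ≡ x)
  where
  a = proj₁ (edge H h)
  b = proj₂ (edge H h)
  x = proj₁ (ends n e)
  y = proj₂ (ends n e)

ImageIs : ∀ {n} (H : Graph) → Vec (Fin n) (verts H) → Vec Bool (nEdges n) → Set
ImageIs {n} H f S =
  ∀ e → (lookup S e ≡ true → ∃ λ h → Hits H f h e)
      × ((∃ λ h → Hits H f h e) → lookup S e ≡ true)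

IsCopy : ∀ {n} (H : Graph) → Vec Bool (nEdges n) → Set
IsCopy {n} H S = ∃ λ (f : Vec (Fin n) (verts H)) → Injective f × ImageIs H f S

anyVec? : ∀ {n} k {P : Vec (Fin n) k → Set} → (∀ v → Dec (P v)) → Dec (∃ P)
anyVec? zero    d with d []
... | yes p = yes ([] , p)
... | no ¬p = no λ { ([] , p) → ¬p p }
anyVec? (suc k) {P} d with any? (λ a → anyVec? k {λ w → P (a ∷ w)} (λ w → d (a ∷ w)))
... | yes (a , w , p) = yes (a ∷ w , p)
... | no ¬p = no λ { (a ∷ w , p) → ¬p (a , w , p) }

injective? : ∀ {n k} (f : Vec (Fin n) k) → Dec (Injective f)
injective? f = all? λ i → all? λ j → (lookup f i FinP.≟ lookup f j) →-dec (i FinP.≟ j)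

hits? : ∀ {n} H f h e → Dec (Hits {n} H f h e)
hits? {n} H f h e =
  ((lookup f _ FinP.≟ _) ×-dec (lookup f _ FinP.≟ _))
  ⊎-dec ((lookup f _ FinP.≟ _) ×-dec (lookup f _ FinP.≟ _))

imageIs? : ∀ {n} H f S → Dec (ImageIs {n} H f S)
imageIs? H f S = all? λ e →
  ((lookup S e ≟B true) →-dec any? (λ h → hits? H f h e))
  ×-dec (any? (λ h → hits? H f h e) →-dec (lookup S e ≟B true))

isCopy? : ∀ {n} H S → Dec (IsCopy {n} H S)
isCopy? H S = anyVec? (verts H) (λ f → injective? f ×-dec imageIs? H f S)

ΣSubsets : (m : ℕ) → (Vec Bool m → ℚ) → ℚ
ΣSubsets zero    F = F []
ΣSubsets (suc m) F = ΣSubsets m (λ S → F (false ∷ S)) + ΣSubsets m (λ S → F (true ∷ S))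

weight : ∀ {n} → EdgeProb n → Vec Bool (nEdges n) → ℚ
weight {n} P S = ΠFin (nEdges n) λ e → sel (lookup S e) (μ P e)
  where
  sel : Bool → ℚ → ℚ
  sel true  q = q
  sel false q = 1ℚ

β : ∀ {n} → EdgeProb n → Graph → ℚ
β {n} P H = ΣSubsets (nEdges n) λ S → 𝟙 (isCopy? {n} H S) (weight P S)

sumSqSupp : ∀ {n} → EdgeProb n → ℚ
sumSqSupp {n} P = ΣFin (nEdges n) λ e → 𝟙 (0ℚ <? μ P e) (μ P e * μ P e)

IsSup : (∀ {n} → EdgeProb n → ℚ) → ℚ → Set
IsSup F c =
  (∀ n (P : EdgeProb n) → F P ≤ c)
  × (∀ (ε : ℚ) → 0ℚ < ε → ∃ λ n → ∃ λ (P : EdgeProb n) → c - ε < F P)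

SupLess : (∀ {n} → EdgeProb n → ℚ) → ℚ → Set
SupLess F c = ∃ λ c′ → c′ < c × (∀ n (P : EdgeProb n) → F P ≤ c′)

F₁ : ∀ {n} → EdgeProb n → ℚ
F₁ P = (+ 2 / 1) * sumSqSupp P + β P (Path 3)

Fm : ℕ → ∀ {n} → EdgeProb n → ℚ
Fm m P = (+ (2 ℕ.* m) / 1) * β P (Cycle m) + β P (Path (suc m))

-- over c m = (c/10) / m^(m-1) for m ≥ 1 (junk value 0 at m = 0, never used)
over : ℕ → ℕ → ℚ
over c zero    = 0ℚ
over c (suc k) = _/_ (+ c) (10 ℕ.* (suc k ℕ.^ k)) {{m*n≢0 10 (suc k ℕ.^ k) {{_}} {{m^n≢0 (suc k) k}}}}

{-# OPTIONS --safe #-}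

module Submission where

-- Write w(x, y) for the mass of the edge xy.  Counting embeddings instead of copies, F(μ) is at
-- most ½ X + Z, where X sums the weights of all injective sequences x₀, …, x_m and Z those of all
-- closed sequences x₀, …, x_{m-1}.  Fix the root edge e = x₀x₁, let b = x_{m-1}x₀ close the cycle,
-- let h be the edge before b, and let s, A, S be the masses of the edges leaving x_{m-2}, x₀ and
-- x_{m-1} for new vertices.  A path of m edges is obtained from x₀, …, x_{m-1} by extending it at
-- either end, so its share in the sum over the last two steps is ½ s (A + S).  In a cycle the
-- product e h b may be replaced by e e h or e e b: a reflection exchanges e with b, or e with h,
-- and 2xy ≤ x² + y².  Altogether the last two steps contribute at most ⅔ (sN + es + eN) with
-- N ≥ A + S, hence at most (2/9) c² where c = e + s + N.  Since the edges charged along a walk are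
-- disjoint, AM-GM over the remaining steps gives F(μ) ≤ (8/9) (m - 1)^-(m - 1).  This is 2/9 for
-- m = 3, and it is below 2.7 / m^(m - 1) for m ≥ 5 because (m / (m - 1))^(m - 1) ≤ 3.  For m = 4 a
-- third reflection exchanges e with x₁x₂, and the bound becomes the sharp 1/32.

open import Defs
open import Data.Bool using (Bool; true; false)
open import Data.Empty using (⊥; ⊥-elim)
open import Data.Fin using (Fin; zero; suc; toℕ; fromℕ; inject₁; opposite; splitAt; _↑ˡ_; _↑ʳ_)
open import Data.Fin.Properties using (suc-injective; toℕ-inject₁; toℕ-fromℕ; toℕ-injective; toℕ<n; splitAt-↑ˡ; splitAt-↑ʳ;
  opposite-involutive; all?)
import Data.Integer as ℤ
import Data.Integer.Properties as ℤₚ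
open import Data.List as List using (List; []; _∷_; length; _++_)
open import Data.List.Membership.Propositional using (_∈_)
open import Data.List.Membership.Propositional.Properties using (∈-tabulate⁻)
open import Data.List.Properties using (length-++; length-tabulate)
open import Data.List.Relation.Unary.All as All using (All; []; _∷_)
import Data.List.Relation.Unary.All.Properties as Allₚ
open import Data.List.Relation.Unary.AllPairs using ([]; _∷_)
open import Data.List.Relation.Unary.Unique.Propositional using (Unique)
import Data.List.Relation.Unary.Unique.Propositional.Properties as Uniqueₚ
open import Data.Nat as ℕ using (ℕ; zero; suc)
import Data.Nat.Properties as ℕₚ
open import Data.Product using (∃; _×_; _,_; proj₁; proj₂)
open import Data.Rational
open import Data.Rational.Properties
import Data.Rational.Unnormalised as ℚᵘ
import Data.Rational.Unnormalised.Properties as ℚᵘₚ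
open import Data.Sum using (_⊎_; inj₁; inj₂)
open import Data.Vec as Vec using (Vec; []; _∷_; _∷ʳ_; reverse; lookup; head)
open import Data.Vec.Properties using (reverse-∷; lookup∘tabulate)
open import Relation.Binary.PropositionalEquality
open import Relation.Nullary using (Dec; yes; no)
open import Relation.Nullary.Decidable using (_×-dec_; dec⇒maybe; from-yes)
open import Tactic.RingSolver using (solve-∀)
open import Tactic.RingSolver.Core.AlmostCommutativeRing using (AlmostCommutativeRing; fromCommutativeRing)

-- The reflections bring the root edge into the quadratic form. Without them the last two steps give
-- only 2sN, which reaches c²/2 at e = 0, although every product contains the factor e. The form sN
-- + es + eN is instead largest at s = e = N, the values on the uniform triangle. The factor 2/3
-- arises because 2(½X + Z) contains 2Z, shared equally by the three forms of the cycle product. For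
-- m ≥ 4 this loses something: the bound is quadratic in c, while c contains three edges of the
-- uniform m-cycle, so AM-GM over the earlier steps is not sharp there. For m = 4 it gives 8/243
-- instead of 1/32. The third reflection repairs this by making the estimate symmetric in e and the
-- first step. The first supremum is obtained separately: 2β(μ; P_3) + 2Σμ(e)² is at most the sum of
-- the squared degrees, hence at most 2, and another Σμ(e)² ≤ 1 is left over. It is attained on a
-- single edge, the other two on the uniform triangle and 4-cycle.

ℚ-ring : AlmostCommutativeRing _ _
ℚ-ring = fromCommutativeRing +-*-commutativeRing (λ x → dec⇒maybe (0ℚ ≟ x))

-- Ordered-ring arithmetic

≤-by-slack : ∀ {x y} d → 0ℚ ≤ d → x + d ≡ y → x ≤ y
≤-by-slack {x} d 0≤d eq =
  subst₂ _≤_ (+-identityʳ x) eq (+-monoʳ-≤ x 0≤d)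

slack≥0 : ∀ {x y} → x ≤ y → 0ℚ ≤ y - x
slack≥0 {x} {y} x≤y = subst (_≤ y - x) (+-inverseʳ x) (+-monoˡ-≤ (- x) x≤y)

+-nonneg : ∀ {x y} → 0ℚ ≤ x → 0ℚ ≤ y → 0ℚ ≤ x + y
+-nonneg = +-mono-≤

*-monoˡ : ∀ {r x y} → 0ℚ ≤ r → x ≤ y → r * x ≤ r * y
*-monoˡ {r} 0≤r = *-monoˡ-≤-nonNeg r {{nonNegative 0≤r}}

*-monoʳ : ∀ {r x y} → 0ℚ ≤ r → x ≤ y → x * r ≤ y * r
*-monoʳ {r} 0≤r = *-monoʳ-≤-nonNeg r {{nonNegative 0≤r}}

*-nonneg : ∀ {x y} → 0ℚ ≤ x → 0ℚ ≤ y → 0ℚ ≤ x * y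
*-nonneg {x} {y} 0≤x 0≤y = subst (_≤ x * y) (*-zeroʳ x) (*-monoˡ 0≤x 0≤y)

*-mono : ∀ {a b c d} → 0ℚ ≤ b → 0ℚ ≤ c → a ≤ b → c ≤ d → a * c ≤ b * d
*-mono 0≤b 0≤c a≤b c≤d = ≤-trans (*-monoʳ 0≤c a≤b) (*-monoˡ 0≤b c≤d)

neg-sq : ∀ x → - x * - x ≡ x * x
neg-sq = solve-∀ ℚ-ring

sq-nonneg : ∀ x → 0ℚ ≤ x * x
sq-nonneg x with ≤-total 0ℚ x
... | inj₁ 0≤x = *-nonneg 0≤x 0≤x
... | inj₂ x≤0 = subst (0ℚ ≤_) (neg-sq x) (*-nonneg (neg-antimono-≤ x≤0) (neg-antimono-≤ x≤0))

-- Finite sums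

-- Only linearity and monotonicity are abstracted, so that one set of lemmas serves sums over
-- vertices, vertex sequences, edge subsets and nested tuples.
record Summation (A : Set) : Set₁ where
  field
    ∑      : (A → ℚ) → ℚ
    ∑-+    : ∀ f g → ∑ (λ a → f a + g a) ≡ ∑ f + ∑ g
    ∑-*    : ∀ c f → ∑ (λ a → c * f a) ≡ c * ∑ f
    ∑-mono : ∀ {f g} → (∀ a → f a ≤ g a) → ∑ f ≤ ∑ g

  ∑-cong : ∀ {f g} → (∀ a → f a ≡ g a) → ∑ f ≡ ∑ g
  ∑-cong eq = ≤-antisym (∑-mono (λ a → ≤-reflexive (eq a)))
                        (∑-mono (λ a → ≤-reflexive (sym (eq a))))

  ∑-0 : ∑ (λ _ → 0ℚ) ≡ 0ℚ
  ∑-0 = trans (∑-* 0ℚ (λ _ → 0ℚ)) (*-zeroˡ (∑ (λ _ → 0ℚ)))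

  ∑-nonneg : ∀ {f} → (∀ a → 0ℚ ≤ f a) → 0ℚ ≤ ∑ f
  ∑-nonneg {f} 0≤f = subst (_≤ ∑ f) ∑-0 (∑-mono 0≤f)

  ∑-*ʳ : ∀ c f → ∑ (λ a → f a * c) ≡ ∑ f * c
  ∑-*ʳ c f = trans (∑-cong (λ a → *-comm (f a) c)) (trans (∑-* c f) (*-comm c (∑ f)))

open Summation

interchange : ∀ a b c d → a + b + (c + d) ≡ a + c + (b + d)
interchange = solve-∀ ℚ-ring

ΣFin-+ : ∀ n (f g : Fin n → ℚ) → ΣFin n (λ i → f i + g i) ≡ ΣFin n f + ΣFin n g
ΣFin-+ zero    f g = refl
ΣFin-+ (suc n) f g =
  trans (cong (f zero + g zero +_) (ΣFin-+ n (λ i → f (suc i)) (λ i → g (suc i))))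
        (interchange (f zero) (g zero) (ΣFin n (λ i → f (suc i))) (ΣFin n (λ i → g (suc i))))

ΣFin-* : ∀ n c (f : Fin n → ℚ) → ΣFin n (λ i → c * f i) ≡ c * ΣFin n f
ΣFin-* zero    c f = sym (*-zeroʳ c)
ΣFin-* (suc n) c f =
  trans (cong (c * f zero +_) (ΣFin-* n c (λ i → f (suc i))))
        (sym (*-distribˡ-+ c (f zero) (ΣFin n (λ i → f (suc i)))))

ΣFin-mono : ∀ n {f g : Fin n → ℚ} → (∀ i → f i ≤ g i) → ΣFin n f ≤ ΣFin n g
ΣFin-mono zero    f≤g = ≤-refl
ΣFin-mono (suc n) f≤g = +-mono-≤ (f≤g zero) (ΣFin-mono n (λ i → f≤g (suc i)))

overFin : ∀ n → Summation (Fin n)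
overFin n = record { ∑ = ΣFin n ; ∑-+ = ΣFin-+ n ; ∑-* = ΣFin-* n ; ∑-mono = ΣFin-mono n }

nested : ∀ {A B C : Set} → (A → B → C) → Summation A → Summation B → Summation C
nested _·_ S T = record
  { ∑      = λ f → ∑ S (λ a → ∑ T (λ b → f (a · b)))
  ; ∑-+    = λ f g → trans (∑-cong S (λ a → ∑-+ T (λ b → f (a · b)) (λ b → g (a · b))))
                           (∑-+ S (λ a → ∑ T (λ b → f (a · b))) (λ a → ∑ T (λ b → g (a · b))))
  ; ∑-*    = λ c f → trans (∑-cong S (λ a → ∑-* T c (λ b → f (a · b))))
                           (∑-* S c (λ a → ∑ T (λ b → f (a · b))))
  ; ∑-mono = λ f≤g → ∑-mono S (λ a → ∑-mono T (λ b → f≤g (a · b)))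
  }

overVec : ∀ n k → Summation (Vec (Fin n) k)
overVec n zero    = record
  { ∑ = λ f → f [] ; ∑-+ = λ _ _ → refl ; ∑-* = λ _ _ → refl ; ∑-mono = λ f≤g → f≤g [] }
overVec n (suc k) = nested _∷_ (overFin n) (overVec n k)

ΣSubsets-+ : ∀ m F G → ΣSubsets m (λ S → F S + G S) ≡ ΣSubsets m F + ΣSubsets m G
ΣSubsets-+ zero    F G = refl
ΣSubsets-+ (suc m) F G = trans
  (cong₂ _+_ (ΣSubsets-+ m (λ S → F (false ∷ S)) (λ S → G (false ∷ S)))
             (ΣSubsets-+ m (λ S → F (true ∷ S)) (λ S → G (true ∷ S))))
  (interchange (ΣSubsets m (λ S → F (false ∷ S))) (ΣSubsets m (λ S → G (false ∷ S)))
               (ΣSubsets m (λ S → F (true ∷ S))) (ΣSubsets m (λ S → G (true ∷ S))))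

ΣSubsets-* : ∀ m c F → ΣSubsets m (λ S → c * F S) ≡ c * ΣSubsets m F
ΣSubsets-* zero    c F = refl
ΣSubsets-* (suc m) c F =
  trans (cong₂ _+_ (ΣSubsets-* m c (λ S → F (false ∷ S))) (ΣSubsets-* m c (λ S → F (true ∷ S))))
        (sym (*-distribˡ-+ c (ΣSubsets m (λ S → F (false ∷ S))) (ΣSubsets m (λ S → F (true ∷ S)))))

ΣSubsets-mono : ∀ m {F G} → (∀ S → F S ≤ G S) → ΣSubsets m F ≤ ΣSubsets m G
ΣSubsets-mono zero    F≤G = F≤G []
ΣSubsets-mono (suc m) F≤G =
  +-mono-≤ (ΣSubsets-mono m (λ S → F≤G (false ∷ S))) (ΣSubsets-mono m (λ S → F≤G (true ∷ S)))

overSubsets : ∀ m → Summation (Vec Bool m)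
overSubsets m = record { ∑ = ΣSubsets m ; ∑-+ = ΣSubsets-+ m ; ∑-* = ΣSubsets-* m ; ∑-mono = ΣSubsets-mono m }

ΣFin-swap : ∀ {A : Set} (S : Summation A) n (f : Fin n → A → ℚ) →
  ΣFin n (λ i → ∑ S (f i)) ≡ ∑ S (λ a → ΣFin n (λ i → f i a))
ΣFin-swap S zero    f = sym (∑-0 S)
ΣFin-swap S (suc n) f =
  trans (cong (∑ S (f zero) +_) (ΣFin-swap S n (λ i → f (suc i))))
        (sym (∑-+ S (f zero) (λ a → ΣFin n (λ i → f (suc i) a))))

∑V-swap : ∀ {A : Set} (S : Summation A) {n} k (f : Vec (Fin n) k → A → ℚ) →
  ∑ (overVec n k) (λ v → ∑ S (f v)) ≡ ∑ S (λ a → ∑ (overVec n k) (λ v → f v a))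
∑V-swap S zero    f = refl
∑V-swap S {n} (suc k) f =
  trans (∑-cong (overFin n) (λ x → ∑V-swap S k (λ v → f (x ∷ v)))) (ΣFin-swap S n (λ x a → ∑ (overVec n k) (λ v → f (x ∷ v) a)))

∑V-cons : ∀ {n} k (f : Vec (Fin n) (suc k) → ℚ) →
  ∑ (overVec n (suc k)) f ≡ ∑ (overVec n k) (λ v → ΣFin n (λ x → f (x ∷ v)))
∑V-cons {n} k f = ΣFin-swap (overVec n k) n (λ x v → f (x ∷ v))

∑V-snoc : ∀ {n} k (f : Vec (Fin n) (suc k) → ℚ) →
  ∑ (overVec n (suc k)) f ≡ ∑ (overVec n k) (λ v → ΣFin n (λ x → f (v ∷ʳ x)))
∑V-snoc zero f = refl
∑V-snoc {n} (suc k) f = ∑-cong (overFin n) (λ y → ∑V-snoc k (λ v → f (y ∷ v)))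

∑V-snocˡ : ∀ {n} k (f : Vec (Fin n) (suc k) → ℚ) →
  ∑ (overVec n (suc k)) f ≡ ΣFin n (λ x → ∑ (overVec n k) (λ v → f (v ∷ʳ x)))
∑V-snocˡ {n} k f = trans (∑V-snoc k f) (∑V-swap (overFin n) k (λ v x → f (v ∷ʳ x)))

∑V-reverse : ∀ {n} k (f : Vec (Fin n) k → ℚ) →
  ∑ (overVec n k) (λ v → f (reverse v)) ≡ ∑ (overVec n k) f
∑V-reverse zero    f = refl
∑V-reverse {n} (suc k) f =
  trans (∑-cong (overFin n) (λ x →
          trans (∑-cong (overVec n k) (λ v → cong f (reverse-∷ x v)))
                (∑V-reverse k (λ v → f (v ∷ʳ x)))))
        (sym (∑V-snocˡ k f))

-- Kronecker deltas and 0-1 indicators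

δ : ∀ {n} → Fin n → Fin n → ℚ
δ zero    zero    = 1ℚ
δ zero    (suc _) = 0ℚ
δ (suc _) zero    = 0ℚ
δ (suc i) (suc j) = δ i j

δ-cases : ∀ {n} (i j : Fin n) → (i ≡ j × δ i j ≡ 1ℚ) ⊎ (i ≢ j × δ i j ≡ 0ℚ)
δ-cases zero    zero    = inj₁ (refl , refl)
δ-cases zero    (suc _) = inj₂ ((λ ()) , refl)
δ-cases (suc _) zero    = inj₂ ((λ ()) , refl)
δ-cases (suc i) (suc j) with δ-cases i j
... | inj₁ (i≡j , eq) = inj₁ (cong suc i≡j , eq)
... | inj₂ (i≢j , eq) = inj₂ ((λ { refl → i≢j refl }) , eq)

δ-sym : ∀ {n} (i j : Fin n) → δ i j ≡ δ j i
δ-sym zero    zero    = refl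
δ-sym zero    (suc _) = refl
δ-sym (suc _) zero    = refl
δ-sym (suc i) (suc j) = δ-sym i j

δ-refl : ∀ {n} (i : Fin n) → δ i i ≡ 1ℚ
δ-refl zero    = refl
δ-refl (suc i) = δ-refl i

0≤1 : 0ℚ ≤ 1ℚ
0≤1 = nonNegative⁻¹ 1ℚ

δ-nonneg : ∀ {n} (i j : Fin n) → 0ℚ ≤ δ i j
δ-nonneg zero    zero    = 0≤1
δ-nonneg zero    (suc _) = ≤-refl
δ-nonneg (suc _) zero    = ≤-refl
δ-nonneg (suc i) (suc j) = δ-nonneg i j

ΣFin-δ : ∀ {n} (i : Fin n) (f : Fin n → ℚ) → ΣFin n (λ j → δ i j * f j) ≡ f i
ΣFin-δ {suc n} zero f = trans
  (cong₂ _+_ (*-identityˡ (f zero))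
    (trans (∑-cong (overFin n) (λ j → *-zeroˡ (f (suc j)))) (∑-0 (overFin n))))
  (+-identityʳ (f zero))
ΣFin-δ {suc n} (suc i) f =
  trans (cong₂ _+_ (*-zeroˡ (f zero)) (ΣFin-δ i (λ j → f (suc j)))) (+-identityˡ (f (suc i)))

-- Distinctness is kept as a 0-1 factor of the weight: sums over injective sequences become sums
-- over all sequences, and their reindexing becomes ring algebra.
ne : ∀ {n} → Fin n → Fin n → ℚ
ne i j = 1ℚ - δ i j

ne-sym : ∀ {n} (i j : Fin n) → ne i j ≡ ne j i
ne-sym i j = cong (λ d → 1ℚ - d) (δ-sym i j)

IsBit : ℚ → Set
IsBit x = x ≡ 0ℚ ⊎ x ≡ 1ℚ

bit-* : ∀ {x y} → IsBit x → IsBit y → IsBit (x * y)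
bit-* {y = y} (inj₁ refl) _ = inj₁ (*-zeroˡ y)
bit-* {y = y} (inj₂ refl) q = subst IsBit (sym (*-identityˡ y)) q

bit-nonneg : ∀ {x} → IsBit x → 0ℚ ≤ x
bit-nonneg (inj₁ refl) = ≤-refl
bit-nonneg (inj₂ refl) = 0≤1

bit≤1 : ∀ {x} → IsBit x → x ≤ 1ℚ
bit≤1 (inj₁ refl) = 0≤1
bit≤1 (inj₂ refl) = ≤-refl

ne-bit : ∀ {n} (i j : Fin n) → IsBit (ne i j)
ne-bit i j with δ-cases i j
... | inj₁ (_ , eq) = inj₁ (cong (λ d → 1ℚ - d) eq)
... | inj₂ (_ , eq) = inj₂ (cong (λ d → 1ℚ - d) eq)

fresh : ∀ {n k} → Fin n → Vec (Fin n) k → ℚ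
fresh y []       = 1ℚ
fresh y (x ∷ xs) = ne y x * fresh y xs

fresh-bit : ∀ {n k} (y : Fin n) (v : Vec (Fin n) k) → IsBit (fresh y v)
fresh-bit y []       = inj₂ refl
fresh-bit y (x ∷ xs) = bit-* (ne-bit y x) (fresh-bit y xs)

fresh-nonneg : ∀ {n k} (y : Fin n) (v : Vec (Fin n) k) → 0ℚ ≤ fresh y v
fresh-nonneg y v = bit-nonneg (fresh-bit y v)

fresh-snoc : ∀ {n k} (y : Fin n) (v : Vec (Fin n) k) z → fresh y (v ∷ʳ z) ≡ fresh y v * ne y z
fresh-snoc y []       z = *-comm (ne y z) 1ℚ
fresh-snoc y (x ∷ xs) z = trans (cong (ne y x *_) (fresh-snoc y xs z)) (sym (*-assoc (ne y x) (fresh y xs) (ne y z)))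

fresh-reverse : ∀ {n k} (y : Fin n) (v : Vec (Fin n) k) → fresh y (reverse v) ≡ fresh y v
fresh-reverse y []       = refl
fresh-reverse y (x ∷ xs) =
  trans (cong (fresh y) (reverse-∷ x xs))
 (trans (fresh-snoc y (reverse xs) x)
 (trans (*-comm (fresh y (reverse xs)) (ne y x)) (cong (ne y x *_) (fresh-reverse y xs))))

-- Powers and the inequality between the means

2ℚ 4ℚ ⅓ ⅙ ⅛ : ℚ
2ℚ = 1ℚ + 1ℚ
4ℚ = 2ℚ + 2ℚ
⅓ = 1ℚ ÷ (2ℚ + 1ℚ)
⅙ = ½ * ⅓
⅛ = ½ * (½ * ½)

+-cancel-halves : ∀ x → ½ * (x + x) ≡ x
+-cancel-halves = solve-∀ ℚ-ring

0≤½ : 0ℚ ≤ ½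
0≤½ = nonNegative⁻¹ ½

ι : ℕ → ℚ
ι zero    = 0ℚ
ι (suc n) = 1ℚ + ι n

ι-nonneg : ∀ n → 0ℚ ≤ ι n
ι-nonneg zero    = ≤-refl
ι-nonneg (suc n) = +-nonneg 0≤1 (ι-nonneg n)

ι-pos : ∀ n → 0ℚ < ι (suc n)
ι-pos n = +-mono-<-≤ (positive⁻¹ 1ℚ) (ι-nonneg n)

recip : ℕ → ℚ
recip n = 1/_ (ι (suc n)) {{>-nonZero (ι-pos n)}}

ι-recip : ∀ n → ι (suc n) * recip n ≡ 1ℚ
ι-recip n = *-inverseʳ (ι (suc n)) {{>-nonZero (ι-pos n)}}

recip-nonneg : ∀ n → 0ℚ ≤ recip n
recip-nonneg n = nonNegative⁻¹ (recip n)
  {{pos⇒nonNeg (recip n) {{1/pos⇒pos (ι (suc n)) {{positive (ι-pos n)}}}}}}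

pow : ℚ → ℕ → ℚ
pow x zero    = 1ℚ
pow x (suc n) = x * pow x n

pow-nonneg : ∀ {x} → 0ℚ ≤ x → ∀ n → 0ℚ ≤ pow x n
pow-nonneg 0≤x zero    = 0≤1
pow-nonneg 0≤x (suc n) = *-nonneg 0≤x (pow-nonneg 0≤x n)

pow-mono : ∀ {x y} → 0ℚ ≤ x → x ≤ y → ∀ n → pow x n ≤ pow y n
pow-mono 0≤x x≤y zero    = ≤-refl
pow-mono 0≤x x≤y (suc n) = *-mono (≤-trans 0≤x x≤y) (pow-nonneg 0≤x n) x≤y (pow-mono 0≤x x≤y n)

-- For p = zⁿ, q = yⁿ⁺¹ and N = n this expresses the tangent gap of exponent n + 2 as y times the
-- gap of exponent n + 1 plus (n + 1) zⁿ (y - z)².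
tangent-step : ∀ y z N p q →
  y * (q + N * (z * p) - (1ℚ + N) * (y * p)) + (1ℚ + N) * (p * ((y - z) * (y - z)))
  ≡ y * q + (1ℚ + N) * (z * (z * p)) - (1ℚ + (1ℚ + N)) * (y * (z * p))
tangent-step = solve-∀ ℚ-ring

-- The graph of y ↦ yⁿ⁺¹ lies above its tangent at z.
tangent : ∀ {y z} → 0ℚ ≤ y → 0ℚ ≤ z → ∀ n →
  0ℚ ≤ pow y (suc n) + ι n * (z * pow z n) - ι (suc n) * (y * pow z n)
tangent {y} {z} 0≤y 0≤z zero = ≤-reflexive (sym (base y z))
  where
  base : ∀ y z → y * 1ℚ + 0ℚ * (z * 1ℚ) - (1ℚ + 0ℚ) * (y * 1ℚ) ≡ 0ℚ
  base = solve-∀ ℚ-ring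
tangent {y} {z} 0≤y 0≤z (suc n) =
  subst (0ℚ ≤_) (tangent-step y z (ι n) (pow z n) (pow y (suc n)))
    (+-nonneg (*-nonneg 0≤y (tangent 0≤y 0≤z n))
      (*-nonneg (ι-nonneg (suc n)) (*-nonneg (pow-nonneg 0≤z n) (sq-nonneg (y - z)))))

-- Let z be the mean of the k + 1 parts of c, and y the mean after s is added. Then s = (k + 2) y -
-- (k + 1) z, and the claim is the tangent inequality for the power k + 2 at z. No roots occur, so
-- the argument stays in ℚ.
am-gm-weighted : ∀ {s c} → 0ℚ ≤ s → 0ℚ ≤ c → ∀ k →
  s * pow (c * recip k) (suc k) ≤ pow ((s + c) * recip (suc k)) (suc (suc k))
am-gm-weighted {s} {c} 0≤s 0≤c k =
  ≤-by-slack _ (tangent 0≤y 0≤z (suc k))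
    (trans (cong (λ t → t * p + (q + ι (suc k) * (z * p) - ι (suc (suc k)) * (y * p))) s≡)
           (collect y z (ι (suc k)) (ι (suc (suc k))) p q))
  where
  z y p q : ℚ
  z = c * recip k
  y = (s + c) * recip (suc k)
  p = pow z (suc k)
  q = pow y (suc (suc k))
  0≤z = *-nonneg 0≤c (recip-nonneg k)
  0≤y = *-nonneg (+-nonneg 0≤s 0≤c) (recip-nonneg (suc k))
  pull : ∀ N t r → N * (t * r) ≡ t * (N * r)
  pull = solve-∀ ℚ-ring
  unscale : ∀ n t → ι (suc n) * (t * recip n) ≡ t
  unscale n t = trans (pull (ι (suc n)) t (recip n)) (trans (cong (t *_) (ι-recip n)) (*-identityʳ t))
  diff : ∀ s c → s ≡ (s + c) - c
  diff = solve-∀ ℚ-ring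
  s≡ : s ≡ ι (suc (suc k)) * y - ι (suc k) * z
  s≡ = trans (diff s c) (sym (cong₂ _-_ (unscale (suc k) (s + c)) (unscale k c)))
  collect : ∀ y z N M p q → (M * y - N * z) * p + (q + N * (z * p) - M * (y * p)) ≡ q
  collect = solve-∀ ℚ-ring

-- The form in which every reflection is used: `K` collects the factors it preserves, and the
-- equality of the two sums of squares records that it exchanges `a` and `b`.
∑-product-≤-squares : ∀ {A : Set} (S : Summation A) (K a b : A → ℚ) → (∀ i → 0ℚ ≤ K i) →
  ∑ S (λ i → K i * (a i * a i)) ≡ ∑ S (λ i → K i * (b i * b i)) →
  ∑ S (λ i → K i * (a i * b i)) ≤ ∑ S (λ i → K i * (a i * a i))
∑-product-≤-squares S K a b 0≤K eq =
  subst₂ _≤_ lhs rhs (*-monoˡ 0≤½ (∑-mono S (λ i →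
    ≤-by-slack _ (*-nonneg (0≤K i) (sq-nonneg (a i - b i))) (square (K i) (a i) (b i)))))
  where
  square : ∀ K a b → K * (a * b) + K * (a * b) + K * ((a - b) * (a - b)) ≡ K * (a * a) + K * (b * b)
  square = solve-∀ ℚ-ring
  lhs = trans (cong (½ *_) (∑-+ S (λ i → K i * (a i * b i)) (λ i → K i * (a i * b i))))
              (+-cancel-halves (∑ S (λ i → K i * (a i * b i))))
  rhs = trans (cong (½ *_) (trans (∑-+ S (λ i → K i * (a i * a i)) (λ i → K i * (b i * b i)))
                                  (cong (∑ S (λ i → K i * (a i * a i)) +_) (sym eq))))
              (+-cancel-halves (∑ S (λ i → K i * (a i * a i))))

endpt : ∀ {A : Set} {k} → Vec A (suc k) → A
endpt (x ∷ [])     = x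
endpt (_ ∷ y ∷ ys) = endpt (y ∷ ys)

endpt-snoc : ∀ {A : Set} {k} (v : Vec A k) z → endpt (v ∷ʳ z) ≡ z
endpt-snoc []           z = refl
endpt-snoc (x ∷ [])     z = refl
endpt-snoc (x ∷ y ∷ ys) z = endpt-snoc (y ∷ ys) z

head-snoc : ∀ {A : Set} {k} (v : Vec A (suc k)) z → head (v ∷ʳ z) ≡ head v
head-snoc (x ∷ v) z = refl

endpt-reverse : ∀ {A : Set} {k} (v : Vec A (suc k)) → endpt (reverse v) ≡ head v
endpt-reverse (x ∷ xs) = trans (cong endpt (reverse-∷ x xs)) (endpt-snoc (reverse xs) x)

head-reverse : ∀ {A : Set} {k} (v : Vec A (suc k)) → head (reverse v) ≡ endpt v
head-reverse (x ∷ [])     = refl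
head-reverse (x ∷ y ∷ ys) =
  trans (cong head (reverse-∷ x (y ∷ ys)))
 (trans (head-snoc (reverse (y ∷ ys)) x) (head-reverse (y ∷ ys)))

-- Allows the distinctness encoded by an indicator to be assumed inside a summand.
when-bit : ∀ {f x y} → IsBit f → (f ≡ 1ℚ → x ≤ y) → f * x ≤ f * y
when-bit {x = x} {y} (inj₁ refl) h = ≤-reflexive (trans (*-zeroˡ x) (sym (*-zeroˡ y)))
when-bit (inj₂ refl) h = *-monoˡ 0≤1 (h refl)

bit-*-1 : ∀ {x y} → IsBit x → IsBit y → x * y ≡ 1ℚ → x ≡ 1ℚ × y ≡ 1ℚ
bit-*-1 (inj₂ refl) (inj₂ refl) _ = refl , refl
bit-*-1 (inj₂ refl) (inj₁ refl) ()
bit-*-1 {y = y} (inj₁ refl) _ eq with trans (sym (*-zeroˡ y)) eq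
... | ()

ΣFin-delete : ∀ {n} (o : Fin n) (f : Fin n → ℚ) → ΣFin n (λ z → ne z o * f z) + f o ≡ ΣFin n f
ΣFin-delete {n} o f =
  trans (cong (ΣFin n (λ z → ne z o * f z) +_) (sym (ΣFin-δ o f)))
 (trans (sym (ΣFin-+ n (λ z → ne z o * f z) (λ z → δ o z * f z)))
        (∑-cong (overFin n) (λ z → trans (cong (λ d → (1ℚ - δ z o) * f z + d * f z) (δ-sym o z))
                                         (complement (δ z o) (f z)))))
  where complement : ∀ d a → (1ℚ - d) * a + d * a ≡ a
        complement = solve-∀ ℚ-ring

fresh-snoc-≤ : ∀ {n k} (y : Fin n) (v : Vec (Fin n) k) z → fresh y (v ∷ʳ z) ≤ fresh y v
fresh-snoc-≤ y v z =
  subst₂ _≤_ (sym (fresh-snoc y v z)) (*-identityʳ (fresh y v))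
    (*-monoˡ (fresh-nonneg y v) (bit≤1 (ne-bit y z)))

-- Quadratic and cubic inequalities for the final steps

⅔ : ℚ
⅔ = ⅓ + ⅓

0≤⅓ : 0ℚ ≤ ⅓
0≤⅓ = nonNegative⁻¹ ⅓
0≤⅔ : 0ℚ ≤ ⅔
0≤⅔ = nonNegative⁻¹ ⅔
0≤⅙ : 0ℚ ≤ ⅙
0≤⅙ = nonNegative⁻¹ ⅙

pairwise-products≤ : ∀ s e N → s * (N + e) + e * N ≤ ⅓ * ((s + (e + N)) * (s + (e + N)))
pairwise-products≤ s e N =
  ≤-by-slack _ (*-nonneg 0≤⅙ (+-nonneg (sq-nonneg (s - e)) (+-nonneg (sq-nonneg (e - N)) (sq-nonneg (s - N)))))
    (identity s e N)
  where
  identity : ∀ s e N →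
    s * (N + e) + e * N + ⅙ * ((s - e) * (s - e) + ((e - N) * (e - N) + (s - N) * (s - N)))
    ≡ ⅓ * ((s + (e + N)) * (s + (e + N)))
  identity = solve-∀ ℚ-ring

-- The largest product of k + 2 nonnegative numbers with sum c; `recip (suc k)` is 1/(k + 2).
Ψ : ℕ → ℚ → ℚ
Ψ k c = pow (c * recip (suc k)) (suc (suc k))

Ψ-mono : ∀ k {x y} → 0ℚ ≤ x → x ≤ y → Ψ k x ≤ Ψ k y
Ψ-mono k 0≤x x≤y =
  pow-mono (*-nonneg 0≤x (recip-nonneg (suc k))) (*-monoʳ (recip-nonneg (suc k)) x≤y) (suc (suc k))

Ψ-nonneg : ∀ k {x} → 0ℚ ≤ x → 0ℚ ≤ Ψ k x
Ψ-nonneg k 0≤x = pow-nonneg (*-nonneg 0≤x (recip-nonneg (suc k))) (suc (suc k))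

¼ : ℚ
¼ = ½ * ½

-- The value 8/9, so that κ * Ψ 0 c = (2/9) c², the bound for e₂(s, e, N) * 2/3 with s + e + N = c.
κ : ℚ
κ = ⅔ * ⅓ * 4ℚ

0≤κ : 0ℚ ≤ κ
0≤κ = nonNegative⁻¹ κ

κΨ₀ : ∀ c → ⅔ * (⅓ * (c * c)) ≡ κ * Ψ 0 c
κΨ₀ = expanded
  where expanded : ∀ c → ⅔ * (⅓ * (c * c)) ≡ κ * (c * ½ * (c * ½ * 1ℚ))
        expanded = solve-∀ ℚ-ring

*-swap : ∀ a b c → a * (b * c) ≡ b * (a * c)
*-swap = solve-∀ ℚ-ring

0≤¼ : 0ℚ ≤ ¼
0≤¼ = nonNegative⁻¹ ¼

0≤⅛ : 0ℚ ≤ ⅛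
0≤⅛ = nonNegative⁻¹ ⅛

product≤¼sum² : ∀ {x y z} → 0ℚ ≤ x → 0ℚ ≤ y → x + y ≤ z → x * y ≤ ¼ * (z * z)
product≤¼sum² {x} {y} {z} 0≤x 0≤y x+y≤z =
  ≤-trans (≤-by-slack (¼ * ((x - y) * (x - y))) (*-nonneg 0≤¼ (sq-nonneg (x - y))) (identity x y))
          (*-monoˡ 0≤¼ (*-mono (≤-trans 0≤s x+y≤z) 0≤s x+y≤z x+y≤z))
  where
  0≤s = +-nonneg 0≤x 0≤y
  identity : ∀ x y → x * y + ¼ * ((x - y) * (x - y)) ≡ ¼ * ((x + y) * (x + y))
  identity = solve-∀ ℚ-ring

-- Sharp at P = e = 1/4, N = 1/2, the values on the uniform 4-cycle. The left side is symmetric in P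
-- and e, so Pe ≤ ¼(P + e)² loses nothing there; with S = P + e it remains to bound SN(S + N)/8.
rooted-4-cycle-bound : ∀ {P e N} → 0ℚ ≤ P → 0ℚ ≤ e → 0ℚ ≤ N → P + (e + N) ≤ 1ℚ →
  P * (½ * (¼ * (N * N) + e * N)) + ½ * (e * (¼ * (N * N))) ≤ ⅛ * ¼
rooted-4-cycle-bound {P} {e} {N} 0≤P 0≤e 0≤N P+e+N≤1 = begin
  P * (½ * (¼ * (N * N) + e * N)) + ½ * (e * (¼ * (N * N)))
    ≡⟨ regroup P e N ⟩
  ⅛ * ((P + e) * N * N) + ½ * (N * (P * e))
    ≤⟨ +-monoʳ-≤ (⅛ * ((P + e) * N * N)) (*-monoˡ 0≤½ (*-monoˡ 0≤N (product≤¼sum² 0≤P 0≤e ≤-refl))) ⟩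
  ⅛ * ((P + e) * N * N) + ½ * (N * (¼ * ((P + e) * (P + e))))
    ≡⟨ collect (P + e) N ⟩
  ⅛ * ((P + e) * N * (P + e + N))
    ≤⟨ *-monoˡ 0≤⅛ (*-mono (*-nonneg 0≤¼ 0≤1) (+-nonneg (+-nonneg 0≤P 0≤e) 0≤N)
         (product≤¼sum² (+-nonneg 0≤P 0≤e) 0≤N S≤1) S≤1) ⟩
  ⅛ * (¼ * (1ℚ * 1ℚ) * 1ℚ) ≡⟨⟩
  ⅛ * ¼ ∎
  where
  open ≤-Reasoning
  S≤1 : P + e + N ≤ 1ℚ
  S≤1 = subst (_≤ 1ℚ) (sym (+-assoc P e N)) P+e+N≤1
  regroup : ∀ P e N → P * (½ * (¼ * (N * N) + e * N)) + ½ * (e * (¼ * (N * N)))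
                    ≡ ⅛ * ((P + e) * N * N) + ½ * (N * (P * e))
  regroup = solve-∀ ℚ-ring
  collect : ∀ S N → ⅛ * (S * N * N) + ½ * (N * (¼ * (S * S))) ≡ ⅛ * (S * N * (S + N))
  collect = solve-∀ ℚ-ring

-- Weighted paths and cycles in an edge-weighted complete graph

module Walks {n : ℕ} (w : Fin n → Fin n → ℚ) (w-nonneg : ∀ x y → 0ℚ ≤ w x y)
             (w-sym : ∀ x y → w x y ≡ w y x)
             (w-total : ΣFin n (λ x → ΣFin n (w x)) ≡ 2ℚ) where

  ∑V : ∀ k → (Vec (Fin n) k → ℚ) → ℚ
  ∑V k = ∑ (overVec n k)

  mass : (Fin n → ℚ) → ℚ
  mass φ = ½ * ΣFin n (λ x → ΣFin n (λ z → φ x * φ z * w x z))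

  mass-nonneg : ∀ {φ} → (∀ x → 0ℚ ≤ φ x) → 0ℚ ≤ mass φ
  mass-nonneg 0≤φ = *-nonneg 0≤½ (∑-nonneg (overFin n) (λ x → ∑-nonneg (overFin n)
    (λ z → *-nonneg (*-nonneg (0≤φ x) (0≤φ z)) (w-nonneg x z))))

  -- With φ = g + δ_y the quadratic form splits into the pairs that avoid y, the star at y counted
  -- twice, and the loop at y. Half of the loop is the slack.
  mass-delete : ∀ φ y → (∀ x → 0ℚ ≤ φ x) → φ y ≡ 1ℚ →
    mass (λ x → ne x y * φ x) + ΣFin n (λ z → ne z y * φ z * w y z) ≤ mass φ
  mass-delete φ y 0≤φ φy≡1 = ≤-by-slack (½ * w y y) (*-nonneg 0≤½ (w-nonneg y y)) (sym (begin
      ½ * Σ₂ (λ x z → φ x * φ z * w x z)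
        ≡⟨ cong (½ *_) (Σ₂-cong (λ x z → trans
             (cong₂ (λ a b → a * b * w x z) (split x) (split z))
             (expand (g x) (g z) (δ y x) (δ y z) (w x z)))) ⟩
      ½ * Σ₂ (λ x z → g x * g z * w x z + (δ y x * (g z * w x z) + δ y z * (g x * w x z + δ y x * w x z)))
        ≡⟨ cong (½ *_) (trans (Σ₂-+ _ _) (cong (Σ₂ (λ x z → g x * g z * w x z) +_) (Σ₂-+ _ _))) ⟩
      ½ * (Σ₂ (λ x z → g x * g z * w x z)
           + (Σ₂ (λ x z → δ y x * (g z * w x z)) + Σ₂ (λ x z → δ y z * (g x * w x z + δ y x * w x z))))
        ≡⟨ cong (λ t → ½ * (Σ₂ (λ x z → g x * g z * w x z) + t)) (cong₂ _+_ row column) ⟩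
      ½ * (Σ₂ (λ x z → g x * g z * w x z) + (R + (R + w y y)))
        ≡⟨ regroup (Σ₂ (λ x z → g x * g z * w x z)) R (w y y) ⟩
      ½ * Σ₂ (λ x z → g x * g z * w x z) + R + ½ * w y y ∎))
    where
    open ≡-Reasoning
    g : Fin n → ℚ
    g x = ne x y * φ x
    R : ℚ
    R = ΣFin n (λ z → g z * w y z)
    Σ₂ : (Fin n → Fin n → ℚ) → ℚ
    Σ₂ f = ΣFin n (λ x → ΣFin n (f x))
    Σ₂-cong : ∀ {f h} → (∀ x z → f x z ≡ h x z) → Σ₂ f ≡ Σ₂ h
    Σ₂-cong eq = ∑-cong (overFin n) (λ x → ∑-cong (overFin n) (eq x))
    Σ₂-+ : ∀ f h → Σ₂ (λ x z → f x z + h x z) ≡ Σ₂ f + Σ₂ h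
    Σ₂-+ f h = trans (∑-cong (overFin n) (λ x → ΣFin-+ n (f x) (h x)))
                     (ΣFin-+ n (λ x → ΣFin n (f x)) (λ x → ΣFin n (h x)))
    split : ∀ x → φ x ≡ g x + δ y x
    split x with δ-cases x y
    ... | inj₁ (refl , eq) = trans φy≡1 (sym (trans (cong₂ (λ d d′ → (1ℚ - d) * φ x + d′) eq eq) (at (φ x))))
      where at : ∀ a → (1ℚ - 1ℚ) * a + 1ℚ ≡ 1ℚ
            at = solve-∀ ℚ-ring
    ... | inj₂ (_ , eq) = sym (trans (cong₂ (λ d d′ → (1ℚ - d) * φ x + d′) eq (trans (δ-sym y x) eq)) (off (φ x)))
      where off : ∀ a → (1ℚ - 0ℚ) * a + 0ℚ ≡ a
            off = solve-∀ ℚ-ring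
    expand : ∀ a b c d w → (a + c) * (b + d) * w ≡ a * b * w + (c * (b * w) + d * (a * w + c * w))
    expand = solve-∀ ℚ-ring
    row : Σ₂ (λ x z → δ y x * (g z * w x z)) ≡ R
    row = trans (∑-cong (overFin n) (λ x → ΣFin-* n (δ y x) (λ z → g z * w x z)))
                (ΣFin-δ y (λ x → ΣFin n (λ z → g z * w x z)))
    column : Σ₂ (λ x z → δ y z * (g x * w x z + δ y x * w x z)) ≡ R + w y y
    column = begin
      Σ₂ (λ x z → δ y z * (g x * w x z + δ y x * w x z))
        ≡⟨ ∑-cong (overFin n) (λ x → ΣFin-δ y (λ z → g x * w x z + δ y x * w x z)) ⟩
      ΣFin n (λ x → g x * w x y + δ y x * w x y)
        ≡⟨ ΣFin-+ n (λ x → g x * w x y) (λ x → δ y x * w x y) ⟩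
      ΣFin n (λ x → g x * w x y) + ΣFin n (λ x → δ y x * w x y)
        ≡⟨ cong₂ _+_ (∑-cong (overFin n) (λ x → cong (g x *_) (w-sym x y))) (ΣFin-δ y (λ x → w x y)) ⟩
      R + w y y ∎
    regroup : ∀ a r b → ½ * (a + (r + (r + b))) ≡ ½ * a + r + ½ * b
    regroup = solve-∀ ℚ-ring

  -- Deleting o before y counts the edge oy only in the star of o, so the two stars are disjoint.
  mass-two-stars : ∀ φ o y → (∀ x → 0ℚ ≤ φ x) → φ o ≡ 1ℚ → φ y ≡ 1ℚ → ne y o ≡ 1ℚ →
    ΣFin n (λ z → ne z o * φ z * w o z) + ΣFin n (λ z → ne z y * (ne z o * φ z) * w y z) ≤ mass φ
  mass-two-stars φ o y 0≤φ φo≡1 φy≡1 y≢o =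
    ≤-trans (≤-by-slack M (mass-nonneg (λ x → *-nonneg (bit-nonneg (ne-bit x y)) (0≤φ′ x)))
              (rearrange A B M))
   (≤-trans (+-monoˡ-≤ A (mass-delete (λ x → ne x o * φ x) y 0≤φ′
              (trans (cong₂ _*_ y≢o φy≡1) (*-identityˡ 1ℚ))))
            (mass-delete φ o 0≤φ φo≡1))
    where
    A B M : ℚ
    A = ΣFin n (λ z → ne z o * φ z * w o z)
    B = ΣFin n (λ z → ne z y * (ne z o * φ z) * w y z)
    M = mass (λ x → ne x y * (ne x o * φ x))
    0≤φ′ : ∀ x → 0ℚ ≤ ne x o * φ x
    0≤φ′ x = *-nonneg (bit-nonneg (ne-bit x o)) (0≤φ x)
    rearrange : ∀ a b m → a + b + m ≡ m + b + a
    rearrange = solve-∀ ℚ-ring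

  -- The weight of the path v, or 0 if v repeats a vertex; walks grow at the head of the vector.
  ψ : ∀ {k} → Vec (Fin n) (suc k) → ℚ
  ψ (x ∷ [])     = 1ℚ
  ψ (y ∷ x ∷ xs) = fresh y (x ∷ xs) * w y x * ψ (x ∷ xs)

  ψ-nonneg : ∀ {k} (v : Vec (Fin n) (suc k)) → 0ℚ ≤ ψ v
  ψ-nonneg (x ∷ [])     = 0≤1
  ψ-nonneg (y ∷ x ∷ xs) =
    *-nonneg (*-nonneg (fresh-nonneg y (x ∷ xs)) (w-nonneg y x)) (ψ-nonneg (x ∷ xs))

  ψ-cons : ∀ {k} y (v : Vec (Fin n) (suc k)) → ψ (y ∷ v) ≡ fresh y v * w y (head v) * ψ v
  ψ-cons y (x ∷ xs) = refl

  ψ-snoc : ∀ {k} (v : Vec (Fin n) (suc k)) z → ψ (v ∷ʳ z) ≡ ψ v * (fresh z v * w (endpt v) z)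
  ψ-snoc (x ∷ []) z = trans (cong (λ t → t * 1ℚ * w x z * 1ℚ) (ne-sym x z)) (base (ne z x) (w x z))
    where base : ∀ a b → a * 1ℚ * b * 1ℚ ≡ 1ℚ * (a * 1ℚ * b)
          base = solve-∀ ℚ-ring
  ψ-snoc (y ∷ x ∷ xs) z =
    trans (cong₂ (λ a b → a * w y x * b)
            (trans (fresh-snoc y (x ∷ xs) z) (cong (fresh y (x ∷ xs) *_) (ne-sym y z)))
            (ψ-snoc (x ∷ xs) z))
          (shuffle (fresh y (x ∷ xs)) (ne z y) (w y x) (ψ (x ∷ xs)) (fresh z (x ∷ xs)) (w (endpt (x ∷ xs)) z))
    where shuffle : ∀ a b c d e f → a * b * c * (d * (e * f)) ≡ a * c * d * (b * e * f)
          shuffle = solve-∀ ℚ-ring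

  ψ-reverse : ∀ {k} (v : Vec (Fin n) (suc k)) → ψ (reverse v) ≡ ψ v
  ψ-reverse (x ∷ [])     = refl
  ψ-reverse (y ∷ x ∷ xs) =
    trans (cong ψ (reverse-∷ y (x ∷ xs)))
   (trans (ψ-snoc (reverse (x ∷ xs)) y)
   (trans (cong₂ _*_ (ψ-reverse (x ∷ xs)) (cong₂ _*_ (fresh-reverse y (x ∷ xs))
             (trans (cong (λ t → w t y) (endpt-reverse (x ∷ xs))) (w-sym x y))))
          (*-comm (ψ (x ∷ xs)) (fresh y (x ∷ xs) * w y x))))

  -- Rooted walks and the reflections of a cycle

  overRooted : ∀ k → Summation (Fin n × Vec (Fin n) (suc k) × Fin n)
  overRooted k = nested _,_ (overFin n) (nested _,_ (overVec n (suc k)) (overFin n))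

  -- A vertex sequence y ∷ (L ∷ʳ o) of length k + 3 is split into its root o, its newest
  -- vertex y and the part L in between.
  ∑R : ∀ k → (Fin n → Vec (Fin n) (suc k) → Fin n → ℚ) → ℚ
  ∑R k f = ∑ (overRooted k) (λ (o , L , y) → f o L y)

  ∑R-cong : ∀ k {f g} → (∀ o L y → f o L y ≡ g o L y) → ∑R k f ≡ ∑R k g
  ∑R-cong k eq = ∑-cong (overRooted k) (λ (o , L , y) → eq o L y)

  ∑R-peel : ∀ k (f : Vec (Fin n) (suc (suc (suc k))) → ℚ) →
    ∑V (suc (suc (suc k))) f ≡ ∑R k (λ o L y → f (y ∷ (L ∷ʳ o)))
  ∑R-peel k f = trans (∑V-cons (suc (suc k)) f) (∑V-snocˡ (suc k) (λ u → ΣFin n (λ y → f (y ∷ u))))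

  -- This is `ψ (L ∷ʳ o)` with the root edge exposed. In the notation of the overview, o is x₀,
  -- `endpt L` is x₁, `head L` is x_{m-2} and the vertex y added next is x_{m-1}, where m = k + 3.
  rooted : ∀ {k} → Fin n → Vec (Fin n) (suc k) → ℚ
  rooted o L = ψ L * (fresh o L * w (endpt L) o)

  ρ : ∀ {k} → Fin n → Vec (Fin n) (suc k) → Fin n → ℚ
  ρ o L y = rooted o L * fresh y (L ∷ʳ o)

  rooted-nonneg : ∀ {k} o (L : Vec (Fin n) (suc k)) → 0ℚ ≤ rooted o L
  rooted-nonneg o L = *-nonneg (ψ-nonneg L) (*-nonneg (fresh-nonneg o L) (w-nonneg (endpt L) o))

  ψ-rooted : ∀ {k} o (L : Vec (Fin n) (suc k)) y → ψ (y ∷ (L ∷ʳ o)) ≡ ρ o L y * w y (head L)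
  ψ-rooted o L y =
    trans (ψ-cons y (L ∷ʳ o))
   (trans (cong₂ (λ x t → fresh y (L ∷ʳ o) * w y x * t) (head-snoc L o) (ψ-snoc L o))
          (swap-factors (fresh y (L ∷ʳ o)) (w y (head L)) (rooted o L)))
    where swap-factors : ∀ a b c → a * b * c ≡ c * a * b
          swap-factors = solve-∀ ℚ-ring

  tipMass : ∀ {k} → Fin n → Vec (Fin n) (suc k) → Fin n → ℚ
  tipMass o L y = ΣFin n (λ z → fresh z (y ∷ (L ∷ʳ o)) * w z y)

  rootMass : ∀ {k} → Fin n → Vec (Fin n) (suc k) → Fin n → ℚ
  rootMass o L y = ΣFin n (λ z → fresh z (y ∷ (L ∷ʳ o)) * w o z)

  paths-extend-tip : ∀ k → ∑V (4 ℕ.+ k) ψ ≡ ∑R k (λ o L y → ρ o L y * (w y (head L) * tipMass o L y))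
  paths-extend-tip k =
    trans (∑V-cons (3 ℕ.+ k) ψ)
   (trans (∑R-peel k (λ v → ΣFin n (λ z → ψ (z ∷ v))))
          (∑R-cong k (λ o L y →
            trans (∑-*ʳ (overFin n) (ψ (y ∷ (L ∷ʳ o))) (λ z → fresh z (y ∷ (L ∷ʳ o)) * w z y))
           (trans (cong (tipMass o L y *_) (ψ-rooted o L y))
                  (swap-factors (tipMass o L y) (ρ o L y) (w y (head L)))))))
    where swap-factors : ∀ a b c → a * (b * c) ≡ b * (c * a)
          swap-factors = solve-∀ ℚ-ring

  paths-extend-root : ∀ k → ∑V (4 ℕ.+ k) ψ ≡ ∑R k (λ o L y → ρ o L y * (w y (head L) * rootMass o L y))
  paths-extend-root k =
    trans (∑V-snoc (3 ℕ.+ k) ψ)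
   (trans (∑R-peel k (λ v → ΣFin n (λ z → ψ (v ∷ʳ z))))
          (∑R-cong k (λ o L y →
            trans (∑-cong (overFin n) (λ z → trans (ψ-snoc (y ∷ (L ∷ʳ o)) z)
              (cong (λ t → ψ (y ∷ (L ∷ʳ o)) * (fresh z (y ∷ (L ∷ʳ o)) * w t z)) (endpt-snoc (y ∷ L) o))))
           (trans (ΣFin-* n (ψ (y ∷ (L ∷ʳ o))) (λ z → fresh z (y ∷ (L ∷ʳ o)) * w o z))
           (trans (cong (_* rootMass o L y) (ψ-rooted o L y))
                  (*-assoc (ρ o L y) (w y (head L)) (rootMass o L y)))))))

  cycles : ℕ → ℚ
  cycles k = ∑V (suc k) (λ v → ψ v * w (head v) (endpt v))

  cycles-rooted : ∀ k → cycles (2 ℕ.+ k) ≡ ∑R k (λ o L y → ρ o L y * (w y (head L) * w y o))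
  cycles-rooted k =
    trans (∑R-peel k (λ v → ψ v * w (head v) (endpt v)))
          (∑R-cong k (λ o L y →
            trans (cong₂ _*_ (ψ-rooted o L y) (cong (w y) (endpt-snoc (y ∷ L) o)))
                  (*-assoc (ρ o L y) (w y (head L)) (w y o))))

  endpt-cons : ∀ {A : Set} {k} (y : A) (v : Vec A (suc k)) → endpt (y ∷ v) ≡ endpt v
  endpt-cons y (x ∷ xs) = refl

  -- The reflection of the cycle that fixes the root exchanges its two edges at the root.
  cycles≤reflected-at-root : ∀ k →
    cycles (2 ℕ.+ k) ≤ ∑R k (λ o L y → ρ o L y * (w y (head L) * w (endpt L) o))
  cycles≤reflected-at-root k =
    subst₂ _≤_
      (trans (∑-cong S (λ (o , t) → cong (K (o , t) *_) (*-comm (w (endpt t) o) (w (head t) o))))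
             (trans (reindex (λ o t → w (head t) o))
             (sym (cycles-rooted k))))
      (trans (reindex (λ o t → w (endpt t) o))
             (∑R-cong k (λ o L y → cong (λ x → ρ o L y * (w y (head L) * w x o)) (endpt-cons y L))))
      (∑-product-≤-squares S K (λ (o , t) → w (endpt t) o) (λ (o , t) → w (head t) o)
        (λ (o , t) → *-nonneg (ψ-nonneg t) (fresh-nonneg o t))
        -- Reversing t = y ∷ L turns the cycle around o and exchanges `head t` with `endpt t`.
        (∑-cong (overFin n) (λ o → trans
          (sym (∑V-reverse (2 ℕ.+ k) (λ t → K (o , t) * (w (endpt t) o * w (endpt t) o))))
          (∑-cong (overVec n (2 ℕ.+ k)) (λ t → cong₂ (λ a b → a * (b * b))
            (cong₂ _*_ (ψ-reverse t) (fresh-reverse o t))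
            (cong (λ x → w x o) (endpt-reverse t)))))))
    where
    S : Summation (Fin n × Vec (Fin n) (2 ℕ.+ k))
    S = nested _,_ (overFin n) (overVec n (2 ℕ.+ k))
    K : Fin n × Vec (Fin n) (2 ℕ.+ k) → ℚ
    K (o , t) = ψ t * fresh o t
    regroup : ∀ fy h p d fo g e →
      fy * h * p * (d * fo) * (g * e) ≡ p * (fo * e) * (fy * d) * (h * g)
    regroup = solve-∀ ℚ-ring
    reindex : (g : Fin n → Vec (Fin n) (2 ℕ.+ k) → ℚ) →
      ∑ S (λ (o , t) → K (o , t) * (g o t * w (endpt t) o))
      ≡ ∑R k (λ o L y → ρ o L y * (w y (head L) * g o (y ∷ L)))
    reindex g = ∑-cong (overFin n) (λ o →
      trans (∑V-cons (suc k) (λ t → K (o , t) * (g o t * w (endpt t) o)))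
            (∑-cong (overVec n (suc k)) (λ L → ∑-cong (overFin n) (λ y →
              trans (cong₂ (λ p x → p * (ne o y * fresh o L) * (g o (y ∷ L) * w x o))
                           (ψ-cons y L) (endpt-cons y L))
             (trans (regroup (fresh y L) (w y (head L)) (ψ L) (ne o y) (fresh o L) (g o (y ∷ L)) (w (endpt L) o))
                    (cong (λ f → rooted o L * f * (w y (head L) * g o (y ∷ L)))
                          (trans (cong (fresh y L *_) (ne-sym o y)) (sym (fresh-snoc y L o)))))))))

  ∑R-swap : ∀ k f → ∑R k f ≡ ∑R k (λ o L y → f y L o)
  ∑R-swap k f =
    trans (ΣFin-swap (overVec n (suc k)) n (λ o L → ΣFin n (λ y → f o L y)))
   (trans (∑-cong (overVec n (suc k)) (λ L → ΣFin-swap (overFin n) n (λ o y → f o L y)))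
          (sym (ΣFin-swap (overVec n (suc k)) n (λ o L → ΣFin n (λ y → f y L o)))))

  -- The reflection of the cycle across the edge between the root and the newest vertex
  -- exchanges the two edges next to that edge.
  cycles≤reflected-across-closing-edge : ∀ k →
    cycles (2 ℕ.+ k) ≤ ∑R k (λ o L y → ρ o L y * (w (endpt L) o * w y o))
  cycles≤reflected-across-closing-edge k =
    subst₂ _≤_
      (trans (∑R-cong k (λ o L y → trans
               (regroup (ψ L) (fresh o L) (fresh y L * ne y o) (w y o) (w (endpt L) o) (w y (head L)))
               (cong (λ f → rooted o L * f * (w y (head L) * w y o)) (sym (fresh-snoc y L o)))))
             (sym (cycles-rooted k)))
      (∑R-cong k (λ o L y → trans
        (regroup (ψ L) (fresh o L) (fresh y L * ne y o) (w y o) (w (endpt L) o) (w (endpt L) o))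
        (cong (λ f → rooted o L * f * (w (endpt L) o * w y o)) (sym (fresh-snoc y L o)))))
      (∑-product-≤-squares (overRooted k) (λ (o , L , y) → K o L y)
        (λ (o , L , y) → w (endpt L) o) (λ (o , L , y) → w y (head L))
        (λ (o , L , y) → *-nonneg (*-nonneg (*-nonneg (ψ-nonneg L) (fresh-nonneg o L))
           (*-nonneg (fresh-nonneg y L) (bit-nonneg (ne-bit y o)))) (w-nonneg y o))
        symmetric)
    where
    K : Fin n → Vec (Fin n) (suc k) → Fin n → ℚ
    K o L y = ψ L * fresh o L * (fresh y L * ne y o) * w y o
    regroup : ∀ p fo f b e h → p * fo * f * b * (e * h) ≡ p * (fo * e) * f * (h * b)
    regroup = solve-∀ ℚ-ring
    exchange : ∀ p fo fy d b → p * fo * (fy * d) * b ≡ p * fy * (fo * d) * b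
    exchange = solve-∀ ℚ-ring
    K-reverse : ∀ o L y → K o (reverse L) y ≡ K o L y
    K-reverse o L y = cong₂ (λ p q → p * (q * ne y o) * w y o)
      (cong₂ _*_ (ψ-reverse L) (fresh-reverse o L)) (fresh-reverse y L)
    K-sym : ∀ o L y → K o L y ≡ K y L o
    K-sym o L y = trans (exchange (ψ L) (fresh o L) (fresh y L) (ne y o) (w y o))
      (cong₂ (λ d b → ψ L * fresh y L * (fresh o L * d) * b) (ne-sym y o) (w-sym y o))
    symmetric : ∑R k (λ o L y → K o L y * (w (endpt L) o * w (endpt L) o))
              ≡ ∑R k (λ o L y → K o L y * (w y (head L) * w y (head L)))
    -- The reflection is the reversal of L followed by the exchange of o and y.
    symmetric =
      trans (∑-cong (overFin n) (λ o → trans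
              (sym (∑V-reverse (suc k) (λ L → ΣFin n (λ y → K o L y * (w (endpt L) o * w (endpt L) o)))))
              (∑-cong (overVec n (suc k)) (λ L → ∑-cong (overFin n) (λ y →
                cong₂ (λ c e → c * (e * e)) (K-reverse o L y) (cong (λ x → w x o) (endpt-reverse L)))))))
     (trans (∑R-swap k (λ o L y → K o L y * (w (head L) o * w (head L) o)))
            (∑R-cong k (λ o L y → cong₂ (λ c h → c * (h * h)) (K-sym y L o) (w-sym (head L) y))))

  -- Disjoint edge sets along a walk

  headMass : ∀ {k} → Fin n → Vec (Fin n) (suc k) → ℚ
  headMass o L = ΣFin n (λ z → fresh z (L ∷ʳ o) * w z (head L))

  avoiding : ∀ {k} → Vec (Fin n) k → ℚ
  avoiding L = mass (λ x → fresh x L)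

  -- The edges from head L to new vertices, the edge from L to its root and the edges avoiding L
  -- are disjoint; a step of the walk spends headMass and does not increase the budget.
  budget : ∀ {k} → Fin n → Vec (Fin n) (suc k) → ℚ
  budget o L = headMass o L + (w (endpt L) o + avoiding L)

  headMass-nonneg : ∀ {k} o (L : Vec (Fin n) (suc k)) → 0ℚ ≤ headMass o L
  headMass-nonneg o L = ∑-nonneg (overFin n) (λ z → *-nonneg (fresh-nonneg z (L ∷ʳ o)) (w-nonneg z (head L)))

  avoiding-nonneg : ∀ {k} (L : Vec (Fin n) k) → 0ℚ ≤ avoiding L
  avoiding-nonneg L = mass-nonneg (λ x → fresh-nonneg x L)

  budget-nonneg : ∀ {k} o (L : Vec (Fin n) (suc k)) → 0ℚ ≤ budget o L
  budget-nonneg o L = +-nonneg (headMass-nonneg o L) (+-nonneg (w-nonneg (endpt L) o) (avoiding-nonneg L))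

  fresh-split : ∀ {k} o (L : Vec (Fin n) k) y → fresh y (L ∷ʳ o) ≡ 1ℚ → fresh y L ≡ 1ℚ × ne y o ≡ 1ℚ
  fresh-split o L y eq = bit-*-1 (fresh-bit y L) (ne-bit y o) (trans (sym (fresh-snoc y L o)) eq)

  -- Once y is added, its star outside L no longer avoids the walk. The next head mass is a part of
  -- this star, the part that also avoids o.
  avoiding-step : ∀ {k} o (L : Vec (Fin n) (suc k)) y → fresh y (L ∷ʳ o) ≡ 1ℚ →
    headMass o (y ∷ L) + avoiding (y ∷ L) ≤ avoiding L
  avoiding-step o L y eq =
    ≤-trans (subst (headMass o (y ∷ L) + avoiding (y ∷ L) ≤_)
                   (+-comm (ΣFin n (λ z → ne z y * fresh z L * w y z)) (avoiding (y ∷ L)))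
                   (+-monoˡ-≤ (avoiding (y ∷ L)) (∑-mono (overFin n) (λ z →
                     subst (λ x → fresh z (y ∷ (L ∷ʳ o)) * w z y ≤ ne z y * fresh z L * x) (w-sym z y)
                       (*-monoʳ (w-nonneg z y) (*-monoˡ (bit-nonneg (ne-bit z y)) (fresh-snoc-≤ z L o)))))))
            (mass-delete (λ x → fresh x L) y (λ x → fresh-nonneg x L) (proj₁ (fresh-split o L y eq)))

  rootStar : ∀ {k} → Fin n → Vec (Fin n) k → ℚ
  rootStar o L = ΣFin n (λ z → fresh z (L ∷ʳ o) * w o z)

  rootStar≡ : ∀ {k} o (L : Vec (Fin n) k) → rootStar o L ≡ ΣFin n (λ z → ne z o * fresh z L * w o z)
  rootStar≡ o L = ∑-cong (overFin n) (λ z →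
    cong (_* w o z) (trans (fresh-snoc z L o) (*-comm (fresh z L) (ne z o))))

  rootStar≤avoiding : ∀ {k} o (L : Vec (Fin n) k) → fresh o L ≡ 1ℚ → rootStar o L ≤ avoiding L
  rootStar≤avoiding o L eq =
    subst (_≤ avoiding L) (sym (rootStar≡ o L))
      (≤-trans (≤-by-slack _ (mass-nonneg (λ x → *-nonneg (bit-nonneg (ne-bit x o)) (fresh-nonneg x L)))
                 (+-comm _ (mass (λ x → ne x o * fresh x L))))
               (mass-delete (λ x → fresh x L) o (λ x → fresh-nonneg x L) eq))

  -- The inequality N ≥ A + S: both o and y lie outside L, so the edges of both stars avoid L.
  stars≤avoiding : ∀ {k} o (L : Vec (Fin n) (suc k)) y → fresh o L ≡ 1ℚ → fresh y (L ∷ʳ o) ≡ 1ℚ →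
    rootStar o L + tipMass o L y ≤ avoiding L
  stars≤avoiding o L y eqo eqy =
    subst (_≤ avoiding L)
      (cong₂ _+_ (sym (rootStar≡ o L)) (∑-cong (overFin n) (λ z → cong₂ (λ f x → ne z y * f * x)
        (trans (*-comm (ne z o) (fresh z L)) (sym (fresh-snoc z L o))) (w-sym y z))))
      (mass-two-stars (λ x → fresh x L) o y (λ x → fresh-nonneg x L) eqo
        (proj₁ (fresh-split o L y eqy)) (proj₂ (fresh-split o L y eqy)))

  -- A path extended at the root must not return to y; the closing edge of the cycle supplies
  -- exactly the missing term of the star at o.
  rootMass+closing≡rootStar : ∀ {k} o (L : Vec (Fin n) (suc k)) y → fresh y (L ∷ʳ o) ≡ 1ℚ →
    rootMass o L y + w y o ≡ rootStar o L
  rootMass+closing≡rootStar o L y eq =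
    trans (cong₂ _+_ (∑-cong (overFin n) (λ z → *-assoc (ne z y) (fresh z (L ∷ʳ o)) (w o z)))
                     (trans (w-sym y o) (sym (trans (cong (_* w o y) eq) (*-identityˡ (w o y))))))
          (ΣFin-delete y (λ z → fresh z (L ∷ʳ o) * w o z))

  rootMass-nonneg : ∀ {k} o (L : Vec (Fin n) (suc k)) y → 0ℚ ≤ rootMass o L y
  rootMass-nonneg o L y =
    ∑-nonneg (overFin n) (λ z → *-nonneg (fresh-nonneg z (y ∷ (L ∷ʳ o))) (w-nonneg o z))

  mass-all : mass (λ _ → 1ℚ) ≡ 1ℚ
  mass-all = trans (cong (½ *_) (trans (∑-cong (overFin n) (λ a → ∑-cong (overFin n) (λ b →
    *-identityˡ (w a b)))) w-total)) (*-inverseʳ ½)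

  budget-single≤1 : ∀ o x → ne o x ≡ 1ℚ → budget o (x ∷ []) ≤ 1ℚ
  budget-single≤1 o x eq =
    subst₂ _≤_ total-left mass-all
      (mass-delete (λ _ → 1ℚ) x (λ _ → 0≤1) refl)
    where
    s U : ℚ
    s = headMass o (x ∷ [])
    U = avoiding (x ∷ [])
    star : ΣFin n (λ z → ne z x * 1ℚ * w x z) ≡ s + w x o
    star = trans (sym (ΣFin-delete o (λ z → ne z x * 1ℚ * w x z)))
      (cong₂ _+_ (∑-cong (overFin n) (λ z → trans (cong (λ t → ne z o * (ne z x * 1ℚ * t)) (w-sym x z))
                                                  (reorder (ne z o) (ne z x) (w z x))))
                 (trans (cong (λ t → t * 1ℚ * w x o) eq) (*-identityˡ (w x o))))
      where reorder : ∀ a b c → a * (b * 1ℚ * c) ≡ b * (a * 1ℚ) * c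
            reorder = solve-∀ ℚ-ring
    total-left : U + ΣFin n (λ z → ne z x * 1ℚ * w x z) ≡ s + (w x o + U)
    total-left = trans (cong (U +_) star) (trans (+-comm U (s + w x o)) (+-assoc s (w x o) U))

  budget-step : ∀ {k} o (L : Vec (Fin n) (suc k)) y → fresh y (L ∷ʳ o) ≡ 1ℚ →
    budget o (y ∷ L) ≤ w (endpt L) o + avoiding L
  budget-step o L y eq =
    subst (_≤ w (endpt L) o + avoiding L)
      (trans (rotate (w (endpt L) o) (headMass o (y ∷ L)) (avoiding (y ∷ L)))
             (cong (λ x → headMass o (y ∷ L) + (w x o + avoiding (y ∷ L))) (sym (endpt-cons y L))))
      (+-monoʳ-≤ (w (endpt L) o) (avoiding-step o L y eq))
    where rotate : ∀ a b c → a + (b + c) ≡ b + (a + c)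
          rotate = solve-∀ ℚ-ring

  rooted-cons : ∀ {k} o (L : Vec (Fin n) (suc k)) y →
    rooted o (y ∷ L) ≡ rooted o L * (fresh y (L ∷ʳ o) * w y (head L))
  rooted-cons o L y =
    trans (cong₂ (λ p x → p * (ne o y * fresh o L * w x o)) (ψ-cons y L) (endpt-cons y L))
   (trans (regroup (fresh y L) (w y (head L)) (ψ L) (ne o y) (fresh o L) (w (endpt L) o))
          (cong (λ f → rooted o L * (f * w y (head L)))
                (trans (cong (fresh y L *_) (ne-sym o y)) (sym (fresh-snoc y L o)))))
    where regroup : ∀ f h p d fo e → f * h * p * (d * fo * e) ≡ p * (fo * e) * (f * d * h)
          regroup = solve-∀ ℚ-ring

  edges≡2 : ΣFin n (λ o → ΣFin n (λ x → w x o)) ≡ 2ℚ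
  edges≡2 = trans (∑-cong (overFin n) (λ o → ∑-cong (overFin n) (λ x → w-sym x o))) w-total

  -- The start of every walk estimate: counted in both orientations, the root edges have total mass
  -- 2.
  ∑-single-≤ : ∀ {f : Fin n → Fin n → ℚ} {C} → 0ℚ ≤ C → (∀ o x → ne o x ≡ 1ℚ → f o x ≤ C) →
    ΣFin n (λ o → ΣFin n (λ x → rooted o (x ∷ []) * f o x)) ≤ 2ℚ * C
  ∑-single-≤ {f} {C} 0≤C f≤C =
    subst (ΣFin n (λ o → ΣFin n (λ x → rooted o (x ∷ []) * f o x)) ≤_)
      (trans (∑-cong (overFin n) (λ o → ∑-*ʳ (overFin n) C (λ x → w x o)))
      (trans (∑-*ʳ (overFin n) C (λ o → ΣFin n (λ x → w x o)))
             (cong (_* C) edges≡2)))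
      (∑-mono (overFin n) (λ o → ∑-mono (overFin n) (bound o)))
    where
    first : ∀ d e p → 1ℚ * (d * 1ℚ * e) * p ≡ d * (e * p)
    first = solve-∀ ℚ-ring
    bound : ∀ o x → rooted o (x ∷ []) * f o x ≤ w x o * C
    bound o x =
      subst (_≤ w x o * C) (sym (first (ne o x) (w x o) (f o x)))
        (≤-trans (when-bit (ne-bit o x) (λ eq → *-monoˡ (w-nonneg x o) (f≤C o x eq)))
                 (subst (ne o x * (w x o * C) ≤_) (*-identityˡ (w x o * C))
                   (*-monoʳ (*-nonneg (w-nonneg x o) 0≤C) (bit≤1 (ne-bit o x)))))

  ∑-step≤ : ∀ {k} o (L : Vec (Fin n) (suc k)) (q : Fin n → ℚ) {C} →
    (∀ y → fresh y (L ∷ʳ o) ≡ 1ℚ → q y ≤ C) →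
    ΣFin n (λ y → rooted o (y ∷ L) * q y) ≤ rooted o L * (headMass o L * C)
  ∑-step≤ o L q {C} q≤C = begin
    ΣFin n (λ y → rooted o (y ∷ L) * q y)
      ≡⟨ ∑-cong (overFin n) (λ y → trans (cong (_* q y) (rooted-cons o L y))
           (reassoc (rooted o L) (fresh y (L ∷ʳ o)) (w y (head L)) (q y))) ⟩
    ΣFin n (λ y → rooted o L * (fresh y (L ∷ʳ o) * (w y (head L) * q y)))
      ≡⟨ ΣFin-* n (rooted o L) (λ y → fresh y (L ∷ʳ o) * (w y (head L) * q y)) ⟩
    rooted o L * ΣFin n (λ y → fresh y (L ∷ʳ o) * (w y (head L) * q y))
      ≤⟨ *-monoˡ (rooted-nonneg o L) (∑-mono (overFin n) (λ y → when-bit (fresh-bit y (L ∷ʳ o)) (λ eq →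
           *-monoˡ (w-nonneg y (head L)) (q≤C y eq)))) ⟩
    rooted o L * ΣFin n (λ y → fresh y (L ∷ʳ o) * (w y (head L) * C))
      ≡⟨ cong (rooted o L *_) (trans
           (∑-cong (overFin n) (λ y → sym (*-assoc (fresh y (L ∷ʳ o)) (w y (head L)) C)))
           (∑-*ʳ (overFin n) C (λ y → fresh y (L ∷ʳ o) * w y (head L)))) ⟩
    rooted o L * (headMass o L * C) ∎
    where
    open ≤-Reasoning
    reassoc : ∀ a b c d → a * (b * c) * d ≡ a * (b * (c * d))
    reassoc = solve-∀ ℚ-ring

  -- Vertices are removed from the growing end. Summing over the newest vertex leaves the head mass
  -- times `Ψ k` of what remains of the budget, and AM-GM turns this into `Ψ (suc k)` of the
  -- preceding budget, until only the root edge is left.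
  ∑-rooted-Ψ : ∀ j k →
    ΣFin n (λ o → ∑V (suc j) (λ L → rooted o L * Ψ k (budget o L))) ≤ 2ℚ * Ψ (j ℕ.+ k) 1ℚ
  ∑-rooted-Ψ zero k = ∑-single-≤ (Ψ-nonneg k 0≤1) (λ o x eq →
    Ψ-mono k (budget-nonneg o (x ∷ [])) (budget-single≤1 o x eq))
  ∑-rooted-Ψ (suc j) k =
    ≤-trans (∑-mono (overFin n) (λ o →
              subst (_≤ ∑V (suc j) (λ L → rooted o L * Ψ (suc k) (budget o L)))
                (sym (∑V-cons (suc j) (λ L → rooted o L * Ψ k (budget o L))))
                (∑-mono (overVec n (suc j)) (bound o))))
            (subst (λ i → ΣFin n (λ o → ∑V (suc j) (λ L → rooted o L * Ψ (suc k) (budget o L))) ≤ 2ℚ * Ψ i 1ℚ)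
              (ℕₚ.+-suc j k) (∑-rooted-Ψ j (suc k)))
    where
    bound : ∀ o (L : Vec (Fin n) (suc j)) →
      ΣFin n (λ y → rooted o (y ∷ L) * Ψ k (budget o (y ∷ L))) ≤ rooted o L * Ψ (suc k) (budget o L)
    bound o L = ≤-trans
      (∑-step≤ o L (λ y → Ψ k (budget o (y ∷ L))) (λ y eq → Ψ-mono k (budget-nonneg o (y ∷ L)) (budget-step o L y eq)))
      (*-monoˡ (rooted-nonneg o L) (am-gm-weighted (headMass-nonneg o L)
        (+-nonneg (w-nonneg (endpt L) o) (avoiding-nonneg L)) (suc k)))

  -- The last two steps of the walk

  Ω : ∀ k → (Fin n → Vec (Fin n) (suc k) → Fin n → ℚ) → ℚ
  Ω k f = ∑R k (λ o L y → ρ o L y * f o L y)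

  Ω-+ : ∀ k f g → Ω k (λ o L y → f o L y + g o L y) ≡ Ω k f + Ω k g
  Ω-+ k f g = trans (∑R-cong k (λ o L y → *-distribˡ-+ (ρ o L y) (f o L y) (g o L y)))
    (∑-+ (overRooted k) (λ (o , L , y) → ρ o L y * f o L y) (λ (o , L , y) → ρ o L y * g o L y))

  Ω-* : ∀ k c f → Ω k (λ o L y → c * f o L y) ≡ c * Ω k f
  Ω-* k c f = trans (∑R-cong k (λ o L y → *-swap (ρ o L y) c (f o L y)))
    (∑-* (overRooted k) c (λ (o , L , y) → ρ o L y * f o L y))

  module _ {k : ℕ} (o : Fin n) (L : Vec (Fin n) (suc k)) (y : Fin n) where
    tipPaths rootPaths closings reflected₁ reflected₂ : ℚ
    tipPaths   = w y (head L) * tipMass o L y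
    rootPaths  = w y (head L) * rootMass o L y
    closings   = w y (head L) * w y o
    reflected₁ = w y (head L) * w (endpt L) o
    reflected₂ = w (endpt L) o * w y o

    combination : ℚ → ℚ
    combination t = ½ * tipPaths + (½ * rootPaths + (t * closings + (t * reflected₁ + t * reflected₂)))

  Ω-combination : ∀ k t → Ω k (λ o L y → combination o L y t) ≡
    ½ * Ω k tipPaths + (½ * Ω k rootPaths + (t * Ω k closings + (t * Ω k reflected₁ + t * Ω k reflected₂)))
  Ω-combination k t =
    trans (Ω-+ k (λ o L y → ½ * tipPaths o L y) (λ o L y → ½ * rootPaths o L y +
             (t * closings o L y + (t * reflected₁ o L y + t * reflected₂ o L y))))
   (cong₂ _+_ (Ω-* k ½ tipPaths)
     (trans (Ω-+ k (λ o L y → ½ * rootPaths o L y)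
               (λ o L y → t * closings o L y + (t * reflected₁ o L y + t * reflected₂ o L y)))
     (cong₂ _+_ (Ω-* k ½ rootPaths)
       (trans (Ω-+ k (λ o L y → t * closings o L y) (λ o L y → t * reflected₁ o L y + t * reflected₂ o L y))
       (cong₂ _+_ (Ω-* k t closings)
         (trans (Ω-+ k (λ o L y → t * reflected₁ o L y) (λ o L y → t * reflected₂ o L y))
           (cong₂ _+_ (Ω-* k t reflected₁) (Ω-* k t reflected₂))))))))

  -- Half of the paths are extended at the tip and half at the root, and the cycles are split
  -- evenly between the original and the two reflected weights.
  paths+cycles≤Ω : ∀ k {t} → 0ℚ ≤ t →
    ∑V (4 ℕ.+ k) ψ + (t + (t + t)) * cycles (2 ℕ.+ k) ≤ Ω k (λ o L y → combination o L y t)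
  paths+cycles≤Ω k {t} 0≤t =
    subst₂ _≤_ (weigh t (∑V (4 ℕ.+ k) ψ) (cycles (2 ℕ.+ k))) (sym (Ω-combination k t))
      (+-mono-≤ (≤-reflexive (cong (½ *_) (paths-extend-tip k)))
      (+-mono-≤ (≤-reflexive (cong (½ *_) (paths-extend-root k)))
      (+-mono-≤ (≤-reflexive (cong (t *_) (cycles-rooted k)))
      (+-mono-≤ (*-monoˡ 0≤t (cycles≤reflected-at-root k))
                (*-monoˡ 0≤t (cycles≤reflected-across-closing-edge k))))))
    where weigh : ∀ t p z → ½ * p + (½ * p + (t * z + (t * z + t * z))) ≡ p + (t + (t + t)) * z
          weigh = solve-∀ ℚ-ring

  rooted-≤ : ∀ {k} o (L : Vec (Fin n) (suc k)) {x y} → (fresh o L ≡ 1ℚ → x ≤ y) →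
    rooted o L * x ≤ rooted o L * y
  rooted-≤ o L {x} {y} h =
    subst₂ _≤_ (regroup (fresh o L) (ψ L) (w (endpt L) o) x) (regroup (fresh o L) (ψ L) (w (endpt L) o) y)
      (*-monoˡ (ψ-nonneg L) (when-bit (fresh-bit o L) (λ eq → *-monoˡ (w-nonneg (endpt L) o) (h eq))))
    where regroup : ∀ f p e x → p * (f * (e * x)) ≡ p * (f * e) * x
          regroup = solve-∀ ℚ-ring

  Ω-≤ : ∀ k {f} (Q : Fin n → Vec (Fin n) (suc k) → ℚ) →
    (∀ o L → fresh o L ≡ 1ℚ → ΣFin n (λ y → fresh y (L ∷ʳ o) * f o L y) ≤ Q o L) →
    Ω k f ≤ ΣFin n (λ o → ∑V (suc k) (λ L → rooted o L * Q o L))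
  Ω-≤ k {f} Q f≤Q = ∑-mono (overFin n) (λ o → ∑-mono (overVec n (suc k)) (λ L →
    subst (_≤ rooted o L * Q o L)
      (trans (sym (ΣFin-* n (rooted o L) (λ y → fresh y (L ∷ʳ o) * f o L y)))
             (∑-cong (overFin n) (λ y → sym (*-assoc (rooted o L) (fresh y (L ∷ʳ o)) (f o L y)))))
      (rooted-≤ o L (f≤Q o L))))

  ∑-closing : ∀ {k} o (L : Vec (Fin n) (suc k)) → ΣFin n (λ y → fresh y (L ∷ʳ o) * w y o) ≡ rootStar o L
  ∑-closing o L = ∑-cong (overFin n) (λ y → cong (fresh y (L ∷ʳ o) *_) (w-sym y o))

  ∑-linear : ∀ {k} o (L : Vec (Fin n) (suc k)) a b →
    ΣFin n (λ y → fresh y (L ∷ʳ o) * (w y (head L) * a + b * w y o)) ≡ headMass o L * a + b * rootStar o L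
  ∑-linear o L a b =
    trans (∑-cong (overFin n) (λ y → regroup (fresh y (L ∷ʳ o)) (w y (head L)) a b (w y o)))
   (trans (ΣFin-+ n (λ y → fresh y (L ∷ʳ o) * w y (head L) * a) (λ y → b * (fresh y (L ∷ʳ o) * w y o)))
          (cong₂ _+_ (∑-*ʳ (overFin n) a (λ y → fresh y (L ∷ʳ o) * w y (head L)))
             (trans (ΣFin-* n b (λ y → fresh y (L ∷ʳ o) * w y o)) (cong (b *_) (∑-closing o L)))))
    where regroup : ∀ f h a b c → f * (h * a + b * c) ≡ f * h * a + b * (f * c)
          regroup = solve-∀ ℚ-ring

  -- Half of the closing term completes the paths extended at the root: ½h(R + b + S) = ½h(A + S) ≤
  -- ½hN. The remaining (t - ½)hb is at most (t - ½)hN, which is where ½ ≤ t enters. The two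
  -- reflected terms are kept as they are.
  combination≤ : ∀ {k t} o (L : Vec (Fin n) (suc k)) y → ½ ≤ t → fresh o L ≡ 1ℚ → fresh y (L ∷ʳ o) ≡ 1ℚ →
    combination o L y t ≤ w y (head L) * (t * (avoiding L + w (endpt L) o)) + t * w (endpt L) o * w y o
  combination≤ {k} {t} o L y ½≤t eqo eqy =
    ≤-by-slack
      (h * (½ * (N - (A + S)) + (t - ½) * (N - b)))
      (*-nonneg (w-nonneg y (head L)) (+-nonneg
        (*-nonneg 0≤½ (slack≥0 (stars≤avoiding o L y eqo eqy)))
        (*-nonneg (slack≥0 ½≤t) (slack≥0 b≤N))))
      (trans (cong (λ a → ½ * (h * S) + (½ * (h * R) + (t * (h * b) + (t * (h * e) + t * (e * b))))
                          + h * (½ * (N - (a + S)) + (t - ½) * (N - b))) (sym R+b≡A))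
             (identity h S R b e N t))
    where
    h S R b e N A : ℚ
    h = w y (head L)
    S = tipMass o L y
    R = rootMass o L y
    b = w y o
    e = w (endpt L) o
    N = avoiding L
    A = rootStar o L
    R+b≡A : R + b ≡ A
    R+b≡A = rootMass+closing≡rootStar o L y eqy
    b≤N : b ≤ N
    b≤N = ≤-trans (≤-by-slack R (rootMass-nonneg o L y) (trans (+-comm b R) R+b≡A)) (rootStar≤avoiding o L eqo)
    identity : ∀ h S R b e N t →
      ½ * (h * S) + (½ * (h * R) + (t * (h * b) + (t * (h * e) + t * (e * b))))
        + h * (½ * (N - (R + b + S)) + (t - ½) * (N - b))
      ≡ h * (t * (N + e)) + t * e * b
    identity = solve-∀ ℚ-ring

  ∑-combination≤ : ∀ {k t} o (L : Vec (Fin n) (suc k)) → ½ ≤ t → fresh o L ≡ 1ℚ →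
    ΣFin n (λ y → fresh y (L ∷ʳ o) * combination o L y t)
    ≤ t * (headMass o L * (avoiding L + w (endpt L) o) + w (endpt L) o * avoiding L)
  ∑-combination≤ {k} {t} o L ½≤t eqo =
    ≤-trans (∑-mono (overFin n) (λ y → when-bit (fresh-bit y (L ∷ʳ o)) (combination≤ o L y ½≤t eqo)))
   (≤-trans (≤-reflexive (∑-linear o L (t * (avoiding L + w (endpt L) o)) (t * w (endpt L) o)))
   (≤-trans (+-monoʳ-≤ (headMass o L * (t * (avoiding L + w (endpt L) o)))
               (*-monoˡ (*-nonneg (≤-trans 0≤½ ½≤t) (w-nonneg (endpt L) o)) (rootStar≤avoiding o L eqo)))
            (≤-reflexive (factor (headMass o L) t (avoiding L) (w (endpt L) o)))))
    where factor : ∀ s t N e → s * (t * (N + e)) + t * e * N ≡ t * (s * (N + e) + e * N)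
          factor = solve-∀ ℚ-ring

  paths+cycles≤Ψ : ∀ k → ½ * ∑V (4 ℕ.+ k) ψ + cycles (2 ℕ.+ k) ≤ κ * Ψ k 1ℚ
  paths+cycles≤Ψ k = begin
    ½ * ∑V (4 ℕ.+ k) ψ + cycles (2 ℕ.+ k)
      ≡⟨ halve (∑V (4 ℕ.+ k) ψ) (cycles (2 ℕ.+ k)) ⟩
    ½ * (∑V (4 ℕ.+ k) ψ + (⅔ + (⅔ + ⅔)) * cycles (2 ℕ.+ k))
      ≤⟨ *-monoˡ 0≤½ (paths+cycles≤Ω k 0≤⅔) ⟩
    ½ * Ω k (λ o L y → combination o L y ⅔)
      ≤⟨ *-monoˡ 0≤½ (Ω-≤ k (λ o L → κ * Ψ 0 (budget o L)) (λ o L eq →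
           ≤-trans (∑-combination≤ o L ½≤⅔ eq)
          (≤-trans (*-monoˡ 0≤⅔ (pairwise-products≤ (headMass o L) (w (endpt L) o) (avoiding L)))
                   (≤-reflexive (κΨ₀ (budget o L)))))) ⟩
    ½ * ΣFin n (λ o → ∑V (suc k) (λ L → rooted o L * (κ * Ψ 0 (budget o L))))
      ≡⟨ cong (½ *_) (trans
           (∑-cong (overFin n) (λ o → trans
             (∑-cong (overVec n (suc k)) (λ L → *-swap (rooted o L) κ (Ψ 0 (budget o L))))
             (∑-* (overVec n (suc k)) κ (λ L → rooted o L * Ψ 0 (budget o L)))))
           (ΣFin-* n κ (λ o → ∑V (suc k) (λ L → rooted o L * Ψ 0 (budget o L))))) ⟩
    ½ * (κ * ΣFin n (λ o → ∑V (suc k) (λ L → rooted o L * Ψ 0 (budget o L))))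
      ≤⟨ *-monoˡ 0≤½ (*-monoˡ 0≤κ (∑-rooted-Ψ k 0)) ⟩
    ½ * (κ * (2ℚ * Ψ (k ℕ.+ 0) 1ℚ))
      ≡⟨ trans (unhalve κ (Ψ (k ℕ.+ 0) 1ℚ)) (cong (λ i → κ * Ψ i 1ℚ) (ℕₚ.+-identityʳ k)) ⟩
    κ * Ψ k 1ℚ ∎
    where
    open ≤-Reasoning
    ½≤⅔ : ½ ≤ ⅔
    ½≤⅔ = ≤-by-slack ⅙ 0≤⅙ refl
    halve : ∀ p z → ½ * p + z ≡ ½ * (p + (⅔ + (⅔ + ⅔)) * z)
    halve = solve-∀ ℚ-ring
    unhalve : ∀ c x → ½ * (c * (2ℚ * x)) ≡ c * x
    unhalve = solve-∀ ℚ-ring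

  -- The sharp bound for m = 4

  -- The reflection of a 4-cycle in the diagonal through its second and fourth vertex
  -- exchanges the first two edges.
  4-cycles≤reflected-in-diagonal : cycles 3 ≤
    ΣFin n (λ o → ΣFin n (λ x → rooted o (x ∷ []) *
      (w x o * ΣFin n (λ y → fresh y (x ∷ o ∷ []) * (w y o * tipMass o (x ∷ []) y)))))
  4-cycles≤reflected-in-diagonal =
    subst₂ _≤_
      (trans (∑-cong S (λ (o , u , x , y) → unfold (ne u x) (ne o u) (ne o x) (ne y u) (ne y x) (ne y o)
                                                  (w y u) (w y o) (w x o) (w u x)))
             (sym (cycles-rooted 1)))
      (∑-cong (overFin n) (λ o → trans
        (trans (ΣFin-swap (overFin n) n (λ u x → ΣFin n (λ y → K o u x y * (w x o * w x o))))
               (∑-cong (overFin n) (λ x → ΣFin-swap (overFin n) n (λ u y → K o u x y * (w x o * w x o)))))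
        (∑-cong (overFin n) (λ x → sum-out o x))))
      (∑-product-≤-squares S (λ (o , u , x , y) → K o u x y) (λ (o , u , x , y) → w x o) (λ (o , u , x , y) → w u x)
        (λ (o , u , x , y) → K-nonneg o u x y)
        -- Both o and u are adjacent to x and to y; exchanging them preserves K and turns `w x o`
        -- into `w u x`.
        (trans (ΣFin-swap (overFin n) n (λ o u → ΣFin n (λ x → ΣFin n (λ y → K o u x y * (w x o * w x o)))))
               (∑-cong S (λ (o , u , x , y) → cong₂ (λ c e → c * (e * e)) (K-sym u o x y) (w-sym x u)))))
    where
    S : Summation (Fin n × Fin n × Fin n × Fin n)
    S = nested _,_ (overFin n) (nested _,_ (overFin n) (nested _,_ (overFin n) (overFin n)))
    K : Fin n → Fin n → Fin n → Fin n → ℚ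
    K o u x y = ne u x * (ne o u * ne o x) * (ne y u * ne y x * ne y o) * (w y u * w y o)
    K-nonneg : ∀ o u x y → 0ℚ ≤ K o u x y
    K-nonneg o u x y = *-nonneg
      (bit-nonneg (bit-* (bit-* (ne-bit u x) (bit-* (ne-bit o u) (ne-bit o x)))
                         (bit-* (bit-* (ne-bit y u) (ne-bit y x)) (ne-bit y o))))
      (*-nonneg (w-nonneg y u) (w-nonneg y o))
    K-exchange : ∀ a b c d e f g h → a * (b * c) * (d * e * f) * (g * h) ≡ c * (b * a) * (f * e * d) * (h * g)
    K-exchange = solve-∀ ℚ-ring
    K-sym : ∀ o u x y → K o u x y ≡ K u o x y
    K-sym o u x y =
      trans (cong (λ d → ne u x * (d * ne o x) * (ne y u * ne y x * ne y o) * (w y u * w y o)) (ne-sym o u))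
            (K-exchange (ne u x) (ne u o) (ne o x) (ne y u) (ne y x) (ne y o) (w y u) (w y o))
    unfold : ∀ ux ou ox yu yx yo h b e p →
      ux * (ou * ox) * (yu * yx * yo) * (h * b) * (e * p)
      ≡ ux * 1ℚ * p * 1ℚ * (ou * (ox * 1ℚ) * e) * (yu * (yx * (yo * 1ℚ))) * (h * b)
    unfold = solve-∀ ℚ-ring
    fold : ∀ ux ou ox uy yx yo h b e →
      ux * (ou * ox) * (uy * yx * yo) * (h * b) * (e * e)
      ≡ 1ℚ * (ox * 1ℚ * e) * e * (yx * (yo * 1ℚ) * b * (uy * (ux * (ou * 1ℚ)) * h))
    fold = solve-∀ ℚ-ring
    sum-out : ∀ o x → ΣFin n (λ y → ΣFin n (λ u → K o u x y * (w x o * w x o))) ≡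
      rooted o (x ∷ []) * (w x o * ΣFin n (λ y → fresh y (x ∷ o ∷ []) * (w y o * tipMass o (x ∷ []) y)))
    sum-out o x =
      trans (∑-cong (overFin n) (λ y →
        trans (∑-cong (overFin n) (λ u →
                trans (cong₂ (λ d d′ → ne u x * (d * ne o x) * (d′ * ne y x * ne y o) * (w y u * w y o) * (w x o * w x o))
                             (ne-sym o u) (ne-sym y u))
               (trans (cong (λ h → ne u x * (ne u o * ne o x) * (ne u y * ne y x * ne y o) * (h * w y o) * (w x o * w x o))
                            (w-sym y u))
                      (fold (ne u x) (ne u o) (ne o x) (ne u y) (ne y x) (ne y o) (w u y) (w y o) (w x o)))))
       (trans (ΣFin-* n (rooted o (x ∷ []) * w x o)
                 (λ u → fresh y (x ∷ o ∷ []) * w y o * (fresh u (y ∷ x ∷ o ∷ []) * w u y)))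
              (cong (rooted o (x ∷ []) * w x o *_)
                (trans (ΣFin-* n (fresh y (x ∷ o ∷ []) * w y o) (λ u → fresh u (y ∷ x ∷ o ∷ []) * w u y))
                       (*-assoc (fresh y (x ∷ o ∷ [])) (w y o) (tipMass o (x ∷ []) y)))))))
     (trans (ΣFin-* n (rooted o (x ∷ []) * w x o) (λ y → fresh y (x ∷ o ∷ []) * (w y o * tipMass o (x ∷ []) y)))
            (*-assoc (rooted o (x ∷ [])) (w x o) _))

  -- The tip mass is at most N - A for every y, and the closing edges sum to A, so the sum is at
  -- most A(N - A).
  ∑-closing-tips≤ : ∀ {k} o (L : Vec (Fin n) (suc k)) → fresh o L ≡ 1ℚ →
    ΣFin n (λ y → fresh y (L ∷ʳ o) * (w y o * tipMass o L y)) ≤ ¼ * (avoiding L * avoiding L)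
  ∑-closing-tips≤ o L eqo = begin
    ΣFin n (λ y → fresh y (L ∷ʳ o) * (w y o * tipMass o L y))
      ≤⟨ ∑-mono (overFin n) (λ y → when-bit (fresh-bit y (L ∷ʳ o)) (λ eqy → *-monoˡ (w-nonneg y o)
           (subst (_≤ N - A) (cancel A (tipMass o L y)) (+-monoˡ-≤ (- A) (stars≤avoiding o L y eqo eqy))))) ⟩
    ΣFin n (λ y → fresh y (L ∷ʳ o) * (w y o * (N - A)))
      ≡⟨ trans (∑-cong (overFin n) (λ y → sym (*-assoc (fresh y (L ∷ʳ o)) (w y o) (N - A))))
               (trans (∑-*ʳ (overFin n) (N - A) (λ y → fresh y (L ∷ʳ o) * w y o))
                      (cong (_* (N - A)) (∑-closing o L))) ⟩
    A * (N - A)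
      ≤⟨ product≤¼sum² (∑-nonneg (overFin n) (λ z → *-nonneg (fresh-nonneg z (L ∷ʳ o)) (w-nonneg o z)))
           (slack≥0 (rootStar≤avoiding o L eqo)) (≤-reflexive (restore A N)) ⟩
    ¼ * (N * N) ∎
    where
    open ≤-Reasoning
    A N : ℚ
    A = rootStar o L
    N = avoiding L
    cancel : ∀ a s → a + s - a ≡ s
    cancel = solve-∀ ℚ-ring
    restore : ∀ a m → a + (m - a) ≡ m
    restore = solve-∀ ℚ-ring

  paths+4-cycles≤ : ½ * ∑V 5 ψ + cycles 3 ≤ ⅛ * ¼
  paths+4-cycles≤ = begin
    ½ * ∑V 5 ψ + cycles 3
      ≡⟨ divide (∑V 5 ψ) (cycles 3) ⟩
    ½ * (∑V 5 ψ + (½ + (½ + ½)) * cycles 3 + ½ * cycles 3)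
      ≤⟨ *-monoˡ 0≤½ (+-mono-≤ main (*-monoˡ 0≤½ extra)) ⟩
    ½ * (Σ₁ (λ o x → P o x * B o x) + ½ * Σ₁ (λ o x → e o x * D o x))
      ≡⟨ cong (½ *_) (sym linear) ⟩
    ½ * Σ₁ (λ o x → P o x * B o x + ½ * (e o x * D o x))
      ≤⟨ *-monoˡ 0≤½ (∑-single-≤ (nonNegative⁻¹ (⅛ * ¼)) (λ o x eq →
           rooted-4-cycle-bound (headMass-nonneg o (x ∷ [])) (w-nonneg x o) (avoiding-nonneg (x ∷ []))
             (budget-single≤1 o x eq))) ⟩
    ½ * (2ℚ * (⅛ * ¼)) ≡⟨⟩
    ⅛ * ¼ ∎
    where
    open ≤-Reasoning
    Σ₁ : (Fin n → Fin n → ℚ) → ℚ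
    Σ₁ f = ΣFin n (λ o → ΣFin n (λ x → rooted o (x ∷ []) * f o x))
    P e N B D : Fin n → Fin n → ℚ
    P o x = headMass o (x ∷ [])
    e o x = w x o
    N o x = avoiding (x ∷ [])
    B o x = ½ * (¼ * (N o x * N o x) + e o x * N o x)
    D o x = ¼ * (N o x * N o x)
    divide : ∀ p z → ½ * p + z ≡ ½ * (p + (½ + (½ + ½)) * z + ½ * z)
    divide = solve-∀ ℚ-ring
    distribute : ∀ r a b → r * (a + ½ * b) ≡ r * a + ½ * (r * b)
    distribute = solve-∀ ℚ-ring
    linear : Σ₁ (λ o x → P o x * B o x + ½ * (e o x * D o x)) ≡
             Σ₁ (λ o x → P o x * B o x) + ½ * Σ₁ (λ o x → e o x * D o x)
    linear =
      trans (∑-cong T (λ (o , x) → distribute (rooted o (x ∷ [])) (P o x * B o x) (e o x * D o x)))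
     (trans (∑-+ T (λ (o , x) → rooted o (x ∷ []) * (P o x * B o x)) (λ (o , x) → ½ * (rooted o (x ∷ []) * (e o x * D o x))))
            (cong (Σ₁ (λ o x → P o x * B o x) +_) (∑-* T ½ (λ (o , x) → rooted o (x ∷ []) * (e o x * D o x)))))
      where T = nested _,_ (overFin n) (overFin n)
    Q : Fin n → Vec (Fin n) 2 → ℚ
    Q o L = ½ * (headMass o L * (avoiding L + w (endpt L) o) + w (endpt L) o * avoiding L)
    -- Only the product of the two masses beyond u is estimated by AM-GM. The root edge stays a
    -- separate factor, since `rooted-4-cycle-bound` has to balance it against the first step.
    Q≤B : ∀ o x u → fresh u (x ∷ o ∷ []) ≡ 1ℚ → Q o (u ∷ x ∷ []) ≤ B o x
    Q≤B o x u eq = *-monoˡ 0≤½ (subst (_≤ ¼ * (N o x * N o x) + e o x * N o x)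
      (expand (headMass o (u ∷ x ∷ [])) (avoiding (u ∷ x ∷ [])) (e o x))
      (+-mono-≤ (product≤¼sum² (headMass-nonneg o (u ∷ x ∷ [])) (avoiding-nonneg (u ∷ x ∷ [])) step)
                (*-monoˡ (w-nonneg x o) step)))
      where
      step = avoiding-step o (x ∷ []) u eq
      expand : ∀ s m e → s * m + e * (s + m) ≡ s * (m + e) + e * m
      expand = solve-∀ ℚ-ring
    main : ∑V 5 ψ + (½ + (½ + ½)) * cycles 3 ≤ Σ₁ (λ o x → P o x * B o x)
    main =
      ≤-trans (paths+cycles≤Ω 1 0≤½)
     (≤-trans (Ω-≤ 1 Q (λ o L eq → ∑-combination≤ o L ≤-refl eq))
              (∑-mono (overFin n) (λ o → subst (_≤ ΣFin n (λ x → rooted o (x ∷ []) * (P o x * B o x)))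
                (sym (∑V-cons 1 (λ L → rooted o L * Q o L)))
                (∑-mono (overFin n) (λ x → ∑-step≤ o (x ∷ []) (λ u → Q o (u ∷ x ∷ [])) (Q≤B o x))))))
    extra : cycles 3 ≤ Σ₁ (λ o x → e o x * D o x)
    extra = ≤-trans 4-cycles≤reflected-in-diagonal (∑-mono (overFin n) (λ o → ∑-mono (overFin n) (λ x →
      rooted-≤ o (x ∷ []) (λ eq → *-monoˡ (w-nonneg x o) (∑-closing-tips≤ o (x ∷ []) eq)))))

-- From copies to embeddings

term≤ΣFin : ∀ {n} {f : Fin n → ℚ} → (∀ i → 0ℚ ≤ f i) → ∀ i → f i ≤ ΣFin n f
term≤ΣFin {suc n} {f} 0≤f zero =
  ≤-by-slack (ΣFin n (λ i → f (suc i))) (∑-nonneg (overFin n) (λ i → 0≤f (suc i))) refl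
term≤ΣFin {suc n} {f} 0≤f (suc i) =
  ≤-trans (term≤ΣFin (λ j → 0≤f (suc j)) i)
          (≤-by-slack (f zero) (0≤f zero) (+-comm (ΣFin n (λ j → f (suc j))) (f zero)))

ΠFin-cong : ∀ n {f g : Fin n → ℚ} → (∀ i → f i ≡ g i) → ΠFin n f ≡ ΠFin n g
ΠFin-cong zero    eq = refl
ΠFin-cong (suc n) eq = cong₂ _*_ (eq zero) (ΠFin-cong n (λ i → eq (suc i)))

ΠFin-nonneg : ∀ n {f : Fin n → ℚ} → (∀ i → 0ℚ ≤ f i) → 0ℚ ≤ ΠFin n f
ΠFin-nonneg zero    0≤f = 0≤1
ΠFin-nonneg (suc n) 0≤f = *-nonneg (0≤f zero) (ΠFin-nonneg n (λ i → 0≤f (suc i)))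

ΠFin-mono : ∀ n {f g : Fin n → ℚ} → (∀ i → 0ℚ ≤ f i) → (∀ i → f i ≤ g i) → ΠFin n f ≤ ΠFin n g
ΠFin-mono zero    0≤f f≤g = ≤-refl
ΠFin-mono (suc n) 0≤f f≤g =
  *-mono (≤-trans (0≤f zero) (f≤g zero)) (ΠFin-nonneg n (λ i → 0≤f (suc i)))
         (f≤g zero) (ΠFin-mono n (λ i → 0≤f (suc i)) (λ i → f≤g (suc i)))

ΠFin≤1 : ∀ n {f : Fin n → ℚ} → (∀ i → 0ℚ ≤ f i) → (∀ i → f i ≤ 1ℚ) → ΠFin n f ≤ 1ℚ
ΠFin≤1 zero    0≤f f≤1 = ≤-refl
ΠFin≤1 (suc n) 0≤f f≤1 =
  *-mono 0≤1 (ΠFin-nonneg n (λ i → 0≤f (suc i))) (f≤1 zero) (ΠFin≤1 n (λ i → 0≤f (suc i)) (λ i → f≤1 (suc i)))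

erase : ∀ {n} → Fin n → (Fin n → ℚ) → Fin n → ℚ
erase i f j = f j + δ i j * (1ℚ - f j)

erase-cases : ∀ {n} (i : Fin n) f j → (i ≡ j × erase i f j ≡ 1ℚ) ⊎ (i ≢ j × erase i f j ≡ f j)
erase-cases i f j with δ-cases i j
... | inj₁ (i≡j , eq) = inj₁ (i≡j , trans (cong (λ d → f j + d * (1ℚ - f j)) eq) (at (f j)))
  where at : ∀ a → a + 1ℚ * (1ℚ - a) ≡ 1ℚ
        at = solve-∀ ℚ-ring
... | inj₂ (i≢j , eq) = inj₂ (i≢j , trans (cong (λ d → f j + d * (1ℚ - f j)) eq) (off (f j)))
  where off : ∀ a → a + 0ℚ * (1ℚ - a) ≡ a
        off = solve-∀ ℚ-ring

ΠFin-erase : ∀ {n} (i : Fin n) f → ΠFin n f ≡ f i * ΠFin n (erase i f)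
ΠFin-erase {suc n} zero f =
  trans (cong (f zero *_) (ΠFin-cong n (λ j → sym (off (f (suc j))))))
        (at (f zero) (ΠFin n (λ j → erase zero f (suc j))))
  where off : ∀ a → a + 0ℚ * (1ℚ - a) ≡ a
        off = solve-∀ ℚ-ring
        at : ∀ a p → a * p ≡ a * ((a + 1ℚ * (1ℚ - a)) * p)
        at = solve-∀ ℚ-ring
ΠFin-erase {suc n} (suc i) f =
  trans (cong (f zero *_) (ΠFin-erase i (λ j → f (suc j))))
        (off (f zero) (f (suc i)) (ΠFin n (erase i (λ j → f (suc j)))))
  where off : ∀ a b p → a * (b * p) ≡ b * ((a + 0ℚ * (1ℚ - a)) * p)
        off = solve-∀ ℚ-ring

-- Factors outside the image of `g` are at most 1. A factor already used is overwritten by 1 instead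
-- of being removed, which keeps the index type fixed during the induction.
ΠFin-≤-injection : ∀ {n} k (f : Fin n → ℚ) (g : Fin k → Fin n) → (∀ i → 0ℚ ≤ f i) → (∀ i → f i ≤ 1ℚ) →
  (∀ i j → g i ≡ g j → i ≡ j) → ΠFin n f ≤ ΠFin k (λ i → f (g i))
ΠFin-≤-injection {n} zero f g 0≤f f≤1 g-inj = ΠFin≤1 n 0≤f f≤1
ΠFin-≤-injection {n} (suc k) f g 0≤f f≤1 g-inj =
  subst₂ _≤_ (sym (ΠFin-erase (g zero) f))
    (cong (f (g zero) *_) (ΠFin-cong k (λ i → elsewhere i)))
    (*-monoˡ (0≤f (g zero)) (ΠFin-≤-injection k (erase (g zero) f) (λ i → g (suc i)) 0≤f′ f′≤1
      (λ i j eq → suc-injective (g-inj (suc i) (suc j) eq))))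
  where
  0≤f′ : ∀ j → 0ℚ ≤ erase (g zero) f j
  0≤f′ j with erase-cases (g zero) f j
  ... | inj₁ (_ , eq) = subst (0ℚ ≤_) (sym eq) 0≤1
  ... | inj₂ (_ , eq) = subst (0ℚ ≤_) (sym eq) (0≤f j)
  f′≤1 : ∀ j → erase (g zero) f j ≤ 1ℚ
  f′≤1 j with erase-cases (g zero) f j
  ... | inj₁ (_ , eq) = ≤-reflexive eq
  ... | inj₂ (_ , eq) = subst (_≤ 1ℚ) (sym eq) (f≤1 j)
  elsewhere : ∀ i → erase (g zero) f (g (suc i)) ≡ f (g (suc i))
  elsewhere i with erase-cases (g zero) f (g (suc i))
  ... | inj₁ (eq , _) with g-inj zero (suc i) eq
  ...   | ()
  elsewhere i | inj₂ (_ , eq) = eq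

Joins : ∀ n → Edge n → Fin n → Fin n → Set
Joins n e x y = (x ≡ proj₁ (ends n e) × y ≡ proj₂ (ends n e)) ⊎ (x ≡ proj₂ (ends n e) × y ≡ proj₁ (ends n e))

edge-between : ∀ {n} (x y : Fin n) → x ≢ y → ∃ λ (e : Edge n) → Joins n e x y
edge-between {suc n} zero zero x≢y = ⊥-elim (x≢y refl)
edge-between {suc n} zero (suc j) _ = j ↑ˡ nEdges n , joins
  where joins : Joins (suc n) (j ↑ˡ nEdges n) zero (suc j)
        joins rewrite splitAt-↑ˡ n j (nEdges n) = inj₁ (refl , refl)
edge-between {suc n} (suc i) zero _ = i ↑ˡ nEdges n , joins
  where joins : Joins (suc n) (i ↑ˡ nEdges n) (suc i) zero
        joins rewrite splitAt-↑ˡ n i (nEdges n) = inj₂ (refl , refl)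
edge-between {suc n} (suc i) (suc j) i≢j with edge-between i j (λ eq → i≢j (cong suc eq))
... | e , p = n ↑ʳ e , joins p
  where joins : Joins n e i j → Joins (suc n) (n ↑ʳ e) (suc i) (suc j)
        joins q rewrite splitAt-↑ʳ n (nEdges n) e with q
        ... | inj₁ (eq₁ , eq₂) = inj₁ (cong suc eq₁ , cong suc eq₂)
        ... | inj₂ (eq₁ , eq₂) = inj₂ (cong suc eq₁ , cong suc eq₂)

module _ {n : ℕ} (P : EdgeProb n) where

  -- Deltas at the endpoints carry masses from edges to ordered vertex pairs without a search for
  -- the edge; sums over pairs then collapse by `ΣFin-δ`.
  incidence : Edge n → Fin n → Fin n → ℚ
  incidence e x y = δ (proj₁ (ends n e)) x * δ (proj₂ (ends n e)) y
                  + δ (proj₁ (ends n e)) y * δ (proj₂ (ends n e)) x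

  incidence-nonneg : ∀ e x y → 0ℚ ≤ incidence e x y
  incidence-nonneg e x y = +-nonneg
    (*-nonneg (δ-nonneg (proj₁ (ends n e)) x) (δ-nonneg (proj₂ (ends n e)) y))
    (*-nonneg (δ-nonneg (proj₁ (ends n e)) y) (δ-nonneg (proj₂ (ends n e)) x))

  pairMass : Fin n → Fin n → ℚ
  pairMass x y = ΣFin (nEdges n) (λ e → μ P e * incidence e x y)

  pairMass-nonneg : ∀ x y → 0ℚ ≤ pairMass x y
  pairMass-nonneg x y = ∑-nonneg (overFin (nEdges n)) (λ e → *-nonneg (nonneg P e) (incidence-nonneg e x y))

  pairMass-sym : ∀ x y → pairMass x y ≡ pairMass y x
  pairMass-sym x y = ∑-cong (overFin (nEdges n)) (λ e → cong (μ P e *_)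
    (+-comm (δ (proj₁ (ends n e)) x * δ (proj₂ (ends n e)) y) (δ (proj₁ (ends n e)) y * δ (proj₂ (ends n e)) x)))

  ∑-pairMass : ∀ (g : Fin n → Fin n → ℚ) →
    ΣFin n (λ x → ΣFin n (λ y → g x y * pairMass x y)) ≡
    ΣFin (nEdges n) (λ e → μ P e * (g (proj₁ (ends n e)) (proj₂ (ends n e)) + g (proj₂ (ends n e)) (proj₁ (ends n e))))
  ∑-pairMass g =
    trans (∑-cong T (λ (x , y) → sym (ΣFin-* (nEdges n) (g x y) (λ e → μ P e * incidence e x y))))
   (trans (∑-cong (overFin n) (λ x → ΣFin-swap (overFin (nEdges n)) n (λ y e → g x y * (μ P e * incidence e x y))))
   (trans (ΣFin-swap (overFin (nEdges n)) n (λ x e → ΣFin n (λ y → g x y * (μ P e * incidence e x y))))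
          (∑-cong (overFin (nEdges n)) perEdge)))
    where
    T = nested _,_ (overFin n) (overFin n)
    spread : ∀ g m a b c d → g * (m * (a * b + c * d)) ≡ b * (a * (m * g)) + c * (d * (m * g))
    spread = solve-∀ ℚ-ring
    perEdge : ∀ e → ΣFin n (λ x → ΣFin n (λ y → g x y * (μ P e * incidence e x y))) ≡
                    μ P e * (g (proj₁ (ends n e)) (proj₂ (ends n e)) + g (proj₂ (ends n e)) (proj₁ (ends n e)))
    perEdge e =
      trans (∑-cong (overFin n) (λ x →
        trans (∑-cong (overFin n) (λ y → spread (g x y) (μ P e) (δ a x) (δ b y) (δ a y) (δ b x)))
       (trans (ΣFin-+ n (λ y → δ b y * (δ a x * (μ P e * g x y))) (λ y → δ a y * (δ b x * (μ P e * g x y))))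
              (cong₂ _+_ (ΣFin-δ b (λ y → δ a x * (μ P e * g x y))) (ΣFin-δ a (λ y → δ b x * (μ P e * g x y)))))))
     (trans (ΣFin-+ n (λ x → δ a x * (μ P e * g x b)) (λ x → δ b x * (μ P e * g x a)))
     (trans (cong₂ _+_ (ΣFin-δ a (λ x → μ P e * g x b)) (ΣFin-δ b (λ x → μ P e * g x a)))
            (sym (*-distribˡ-+ (μ P e) (g a b) (g b a)))))
      where
      a b : Fin n
      a = proj₁ (ends n e)
      b = proj₂ (ends n e)

  pairMass-total : ΣFin n (λ x → ΣFin n (pairMass x)) ≡ 2ℚ
  pairMass-total =
    trans (∑-cong (overFin n) (λ x → ∑-cong (overFin n) (λ y → sym (*-identityˡ (pairMass x y)))))
   (trans (∑-pairMass (λ _ _ → 1ℚ))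
   (trans (∑-*ʳ (overFin (nEdges n)) 2ℚ (μ P)) (cong (_* 2ℚ) (total P))))

  μ≤pairMass : ∀ e x y → Joins n e x y → μ P e ≤ pairMass x y
  μ≤pairMass e x y joins =
    ≤-trans (subst (_≤ μ P e * incidence e x y) (*-identityʳ (μ P e)) (*-monoˡ (nonneg P e) (1≤incidence joins)))
            (term≤ΣFin (λ e′ → *-nonneg (nonneg P e′) (incidence-nonneg e′ x y)) e)
    where
    1≤incidence : ∀ {x y} → Joins n e x y → 1ℚ ≤ incidence e x y
    1≤incidence {x} {y} (inj₁ (refl , refl)) = ≤-by-slack (δ x y * δ y x) (*-nonneg (δ-nonneg x y) (δ-nonneg y x))
      (cong (_+ δ x y * δ y x) (sym (cong₂ _*_ (δ-refl x) (δ-refl y))))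
    1≤incidence {x} {y} (inj₂ (refl , refl)) = ≤-by-slack (δ y x * δ x y) (*-nonneg (δ-nonneg y x) (δ-nonneg x y))
      (trans (+-comm 1ℚ (δ y x * δ x y)) (cong (δ y x * δ x y +_) (sym (cong₂ _*_ (δ-refl y) (δ-refl x)))))

  μ≤1 : ∀ e → μ P e ≤ 1ℚ
  μ≤1 e = subst (μ P e ≤_) (total P) (term≤ΣFin (nonneg P) e)

  -- The factors of weight are values of a function local to its definition; unification names them.
  factors : ∀ S → ∃ λ φ → weight P S ≡ ΠFin (nEdges n) φ
  factors S = _ , refl

  factor-true : ∀ S e → lookup S e ≡ true → proj₁ (factors S) e ≡ μ P e
  factor-true S e eq rewrite eq = refl

  factor-bounds : ∀ S e → 0ℚ ≤ proj₁ (factors S) e × proj₁ (factors S) e ≤ 1ℚ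
  factor-bounds S e with lookup S e
  ... | true  = nonneg P e , μ≤1 e
  ... | false = 0≤1 , ≤-refl

  weight-nonneg : ∀ S → 0ℚ ≤ weight P S
  weight-nonneg S = ΠFin-nonneg (nEdges n) (λ e → proj₁ (factor-bounds S e))

-- The weight of a copy and of its embeddings

SameEdge : ∀ (H : Graph) → Fin (nE H) → Fin (nE H) → Set
SameEdge H h h′ = (proj₁ (edge H h) ≡ proj₁ (edge H h′) × proj₂ (edge H h) ≡ proj₂ (edge H h′))
                ⊎ (proj₁ (edge H h) ≡ proj₂ (edge H h′) × proj₂ (edge H h) ≡ proj₁ (edge H h′))

record Simple (H : Graph) : Set where
  field
    loopless : ∀ h → proj₁ (edge H h) ≢ proj₂ (edge H h)
    distinct : ∀ h h′ → SameEdge H h h′ → h ≡ h′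
open Simple

joins-unique : ∀ {n} (e : Edge n) {x y x′ y′ : Fin n} → Joins n e x y → Joins n e x′ y′ →
  (x ≡ x′ × y ≡ y′) ⊎ (x ≡ y′ × y ≡ x′)
joins-unique e (inj₁ (refl , refl)) (inj₁ (refl , refl)) = inj₁ (refl , refl)
joins-unique e (inj₁ (refl , refl)) (inj₂ (refl , refl)) = inj₂ (refl , refl)
joins-unique e (inj₂ (refl , refl)) (inj₁ (refl , refl)) = inj₂ (refl , refl)
joins-unique e (inj₂ (refl , refl)) (inj₂ (refl , refl)) = inj₁ (refl , refl)

embeddingWeight : ∀ {n} → EdgeProb n → (H : Graph) → Vec (Fin n) (verts H) → ℚ
embeddingWeight P H f = ΠFin (nE H) (λ h → pairMass P (lookup f (proj₁ (edge H h))) (lookup f (proj₂ (edge H h))))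

-- Simplicity of H makes the image edges distinct, so each selected factor is charged once; all
-- other factors of the weight are at most 1.
weight≤embeddingWeight : ∀ {n} (P : EdgeProb n) {H} → Simple H → ∀ f S → Injective f → ImageIs H f S →
  weight P S ≤ embeddingWeight P H f
weight≤embeddingWeight {n} P {H} simple f S f-inj image =
  ≤-trans (ΠFin-≤-injection (nE H) φ image-edge (λ e → proj₁ (factor-bounds P S e)) (λ e → proj₂ (factor-bounds P S e))
             image-edge-injective)
          (ΠFin-mono (nE H) (λ h → proj₁ (factor-bounds P S (image-edge h))) (λ h →
            subst (_≤ pairMass P _ _) (sym (factor-true P S (image-edge h) (proj₂ (image (image-edge h)) (h , joins h))))
              (μ≤pairMass P (image-edge h) _ _ (joins h))))
  where
  φ = proj₁ (factors P S)
  choice : ∀ h → ∃ λ e → Joins n e (lookup f (proj₁ (edge H h))) (lookup f (proj₂ (edge H h)))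
  choice h = edge-between _ _ (λ eq → loopless simple h (f-inj _ _ eq))
  image-edge : Fin (nE H) → Edge n
  image-edge h = proj₁ (choice h)
  joins : ∀ h → Joins n (image-edge h) (lookup f (proj₁ (edge H h))) (lookup f (proj₂ (edge H h)))
  joins h = proj₂ (choice h)
  same : ∀ {a b a′ b′} → (lookup f a ≡ lookup f a′ × lookup f b ≡ lookup f b′) ⊎ (lookup f a ≡ lookup f b′ × lookup f b ≡ lookup f a′) →
    (a ≡ a′ × b ≡ b′) ⊎ (a ≡ b′ × b ≡ a′)
  same (inj₁ (p , q)) = inj₁ (f-inj _ _ p , f-inj _ _ q)
  same (inj₂ (p , q)) = inj₂ (f-inj _ _ p , f-inj _ _ q)
  image-edge-injective : ∀ h h′ → image-edge h ≡ image-edge h′ → h ≡ h′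
  image-edge-injective h h′ eq = distinct simple h h′
    (same (joins-unique (image-edge h) (joins h) (subst (λ e → Joins n e _ _) (sym eq) (joins h′))))

-- Double counting of copies and embeddings

δⱽ : ∀ {n k} → Vec (Fin n) k → Vec (Fin n) k → ℚ
δⱽ []      []      = 1ℚ
δⱽ (x ∷ u) (y ∷ v) = δ x y * δⱽ u v

∑V-δⱽ : ∀ {n k} (u : Vec (Fin n) k) f → ∑ (overVec n k) (λ v → δⱽ u v * f v) ≡ f u
∑V-δⱽ []      f = *-identityˡ (f [])
∑V-δⱽ {n} {suc k} (x ∷ u) f =
  trans (∑-cong (overFin n) (λ y →
          trans (∑-cong (overVec n k) (λ v → *-assoc (δ x y) (δⱽ u v) (f (y ∷ v))))
         (trans (∑-* (overVec n k) (δ x y) (λ v → δⱽ u v * f (y ∷ v)))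
                (cong (δ x y *_) (∑V-δⱽ u (λ v → f (y ∷ v)))))))
        (ΣFin-δ x (λ y → f (y ∷ u)))

δⱽ-cases : ∀ {n k} (u v : Vec (Fin n) k) → (u ≡ v × δⱽ u v ≡ 1ℚ) ⊎ (u ≢ v × δⱽ u v ≡ 0ℚ)
δⱽ-cases []      []      = inj₁ (refl , refl)
δⱽ-cases (x ∷ u) (y ∷ v) with δ-cases x y | δⱽ-cases u v
... | inj₁ (refl , p) | inj₁ (refl , q) = inj₁ (refl , cong₂ _*_ p q)
... | inj₁ (_ , p)    | inj₂ (u≢v , q)  = inj₂ ((λ { refl → u≢v refl }) , cong₂ _*_ p q)
... | inj₂ (x≢y , p)  | _               = inj₂ ((λ { refl → x≢y refl }) , trans (cong (_* δⱽ u v) p) (*-zeroˡ (δⱽ u v)))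

omit : ∀ {n k} → Vec (Fin n) k → (Vec (Fin n) k → ℚ) → Vec (Fin n) k → ℚ
omit u f v = (1ℚ - δⱽ u v) * f v

omit-other : ∀ {n k} {u v : Vec (Fin n) k} f → u ≢ v → omit u f v ≡ f v
omit-other {u = u} {v} f u≢v with δⱽ-cases u v
... | inj₁ (u≡v , _) = ⊥-elim (u≢v u≡v)
... | inj₂ (_ , eq)  = trans (cong (λ d → (1ℚ - d) * f v) eq) (*-identityˡ (f v))

omit-nonneg : ∀ {n k} (u : Vec (Fin n) k) {f} → (∀ v → 0ℚ ≤ f v) → ∀ v → 0ℚ ≤ omit u f v
omit-nonneg u {f} 0≤f v with δⱽ-cases u v
... | inj₁ (_ , eq) = ≤-reflexive (sym (trans (cong (λ d → (1ℚ - d) * f v) eq) (*-zeroˡ (f v))))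
... | inj₂ (_ , eq) = subst (0ℚ ≤_) (sym (trans (cong (λ d → (1ℚ - d) * f v) eq) (*-identityˡ (f v)))) (0≤f v)

∑V-omit : ∀ {n k} (u : Vec (Fin n) k) f → f u + ∑ (overVec n k) (omit u f) ≡ ∑ (overVec n k) f
∑V-omit {n} {k} u f =
  trans (cong (_+ ∑ (overVec n k) (omit u f)) (sym (∑V-δⱽ u f)))
 (trans (sym (∑-+ (overVec n k) (λ v → δⱽ u v * f v) (omit u f)))
        (∑-cong (overVec n k) (λ v → complement (δⱽ u v) (f v))))
  where complement : ∀ d a → d * a + (1ℚ - d) * a ≡ a
        complement = solve-∀ ℚ-ring

-- After its value has been counted, a listed vector is zeroed by `omit`; uniqueness of the list
-- keeps the later values intact.
count≤∑V : ∀ {n k} {f : Vec (Fin n) k → ℚ} {c} → (∀ v → 0ℚ ≤ f v) →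
  ∀ {L} → Unique L → All (λ v → c ≤ f v) L → ι (length L) * c ≤ ∑ (overVec n k) f
count≤∑V {n} {k} {f} {c} 0≤f [] [] = subst (_≤ ∑ (overVec n k) f) (sym (*-zeroˡ c)) (∑-nonneg (overVec n k) 0≤f)
count≤∑V {n} {k} {f} {c} 0≤f {u ∷ L} (u∉L ∷ unique) (c≤fu ∷ c≤f) =
  subst₂ _≤_ (sym (distrib (ι (length L)) c)) (∑V-omit u f)
    (+-mono-≤ c≤fu (count≤∑V (omit-nonneg u 0≤f) unique
      (All.zipWith (λ (u≢v , c≤fv) → subst (c ≤_) (sym (omit-other f u≢v)) c≤fv) (u∉L , c≤f))))
  where distrib : ∀ l c → (1ℚ + l) * c ≡ c + l * c
        distrib = solve-∀ ℚ-ring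

𝟙-yes : ∀ {A : Set} (d : Dec A) {q} → A → 𝟙 d q ≡ q
𝟙-yes (yes _) _ = refl
𝟙-yes (no ¬a) a = ⊥-elim (¬a a)

𝟙-nonneg : ∀ {A : Set} (d : Dec A) {q} → 0ℚ ≤ q → 0ℚ ≤ 𝟙 d q
𝟙-nonneg (yes _) 0≤q = 0≤q
𝟙-nonneg (no _)  _   = ≤-refl

module _ {c : ℚ} where
  -- The witness strengthens the induction: if both halves of the sum have one, uniqueness is
  -- contradicted, and otherwise one half vanishes.
  ΣSubsets-witness : ∀ m {Q : Vec Bool m → Set} (d : ∀ S → Dec (Q S)) {x : Vec Bool m → ℚ} →
    (∀ S → Q S → x S ≤ c) → (∀ S S′ → Q S → Q S′ → S ≡ S′) →
    (ΣSubsets m (λ S → 𝟙 (d S) (x S)) ≡ 0ℚ) ⊎ (∃ Q × ΣSubsets m (λ S → 𝟙 (d S) (x S)) ≤ c)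
  ΣSubsets-witness zero d x≤c unique with d []
  ... | yes q = inj₂ (([] , q) , x≤c [] q)
  ... | no _  = inj₁ refl
  ΣSubsets-witness (suc m) d {x} x≤c unique
    with ΣSubsets-witness m (λ S → d (false ∷ S)) (λ S → x≤c (false ∷ S))
           (λ S S′ q q′ → cong Vec.tail (unique (false ∷ S) (false ∷ S′) q q′))
       | ΣSubsets-witness m (λ S → d (true ∷ S)) (λ S → x≤c (true ∷ S))
           (λ S S′ q q′ → cong Vec.tail (unique (true ∷ S) (true ∷ S′) q q′))
  ... | inj₁ eq₁ | inj₁ eq₂ = inj₁ (cong₂ _+_ eq₁ eq₂)
  ... | inj₁ eq₁ | inj₂ ((S , q) , le) = inj₂ ((true ∷ S , q) ,
    subst (_≤ c) (sym (trans (cong (_+ ΣSubsets m (λ S → 𝟙 (d (true ∷ S)) (x (true ∷ S)))) eq₁) (+-identityˡ _))) le)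
  ... | inj₂ ((S , q) , le) | inj₁ eq₂ = inj₂ ((false ∷ S , q) ,
    subst (_≤ c) (sym (trans (cong (ΣSubsets m (λ S → 𝟙 (d (false ∷ S)) (x (false ∷ S))) +_) eq₂) (+-identityʳ _))) le)
  ... | inj₂ ((S , q) , _) | inj₂ ((S′ , q′) , _) with unique (false ∷ S) (true ∷ S′) q q′
  ...   | ()

  ΣSubsets-unique≤ : ∀ m {Q : Vec Bool m → Set} (d : ∀ S → Dec (Q S)) {x : Vec Bool m → ℚ} → 0ℚ ≤ c →
    (∀ S → Q S → x S ≤ c) → (∀ S S′ → Q S → Q S′ → S ≡ S′) → ΣSubsets m (λ S → 𝟙 (d S) (x S)) ≤ c
  ΣSubsets-unique≤ m d 0≤c x≤c unique with ΣSubsets-witness m d x≤c unique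
  ... | inj₁ eq       = subst (_≤ c) (sym eq) 0≤c
  ... | inj₂ (_ , le) = le

lookup-ext : ∀ {A : Set} {k} (u v : Vec A k) → (∀ i → lookup u i ≡ lookup v i) → u ≡ v
lookup-ext []      []      eq = refl
lookup-ext (x ∷ u) (y ∷ v) eq = cong₂ _∷_ (eq zero) (lookup-ext u v (λ i → eq (suc i)))

Embeds : ∀ {n} (H : Graph) → Vec Bool (nEdges n) → Vec (Fin n) (verts H) → Set
Embeds H S f = Injective f × ImageIs H f S

image-unique : ∀ {n} H (f : Vec (Fin n) (verts H)) (S S′ : Vec Bool (nEdges n)) → ImageIs H f S → ImageIs H f S′ → S ≡ S′
image-unique H f S S′ image image′ = lookup-ext S S′ agree
  where
  agree : ∀ e → lookup S e ≡ lookup S′ e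
  agree e with lookup S e in eq | lookup S′ e in eq′
  ... | true  | true  = refl
  ... | false | false = refl
  ... | true  | false with trans (sym (proj₂ (image′ e) (proj₁ (image e) eq))) eq′
  ...   | ()
  agree e | false | true with trans (sym (proj₂ (image e) (proj₁ (image′ e) eq′))) eq
  ...   | ()

-- The pairs (S, f) with f an embedding onto S are counted twice: a copy S has at least N
-- embeddings, and an embedding f determines its copy.
count-copies : ∀ {n} (P : EdgeProb n) {H} → Simple H → ∀ N →
  (∀ (f : Vec (Fin n) (verts H)) (S : Vec Bool (nEdges n)) → Embeds H S f → ∃ λ L → Unique L × length L ≡ N × All (Embeds H S) L) →
  ∀ {c} → (∀ f → 0ℚ ≤ c f) → (∀ f → Injective f → embeddingWeight P H f ≤ c f) →
  ι N * β P H ≤ ∑ (overVec n (verts H)) c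
count-copies {n} P {H} simple N automorphisms {c} 0≤c weight≤c = begin
  ι N * β P H
    ≡⟨ sym (∑-* (overSubsets (nEdges n)) (ι N) (λ S → 𝟙 (isCopy? {n} H S) (weight P S))) ⟩
  ΣSubsets (nEdges n) (λ S → ι N * 𝟙 (isCopy? {n} H S) (weight P S))
    ≤⟨ ∑-mono (overSubsets (nEdges n)) perCopy ⟩
  ΣSubsets (nEdges n) (λ S → ∑ (overVec n (verts H)) (λ f → 𝟙 (embeds? S f) (weight P S)))
    ≡⟨ sym (∑V-swap (overSubsets (nEdges n)) (verts H) (λ f S → 𝟙 (embeds? S f) (weight P S))) ⟩
  ∑ (overVec n (verts H)) (λ f → ΣSubsets (nEdges n) (λ S → 𝟙 (embeds? S f) (weight P S)))
    ≤⟨ ∑-mono (overVec n (verts H)) (λ f → ΣSubsets-unique≤ (nEdges n) (λ S → embeds? S f) (0≤c f)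
         (λ S (f-inj , image) → ≤-trans (weight≤embeddingWeight P simple f S f-inj image) (weight≤c f f-inj))
         (λ S S′ (_ , image) (_ , image′) → image-unique H f S S′ image image′)) ⟩
  ∑ (overVec n (verts H)) c ∎
  where
  open ≤-Reasoning
  embeds? : ∀ (S : Vec Bool (nEdges n)) (f : Vec (Fin n) (verts H)) → Dec (Embeds H S f)
  embeds? S f = injective? f ×-dec imageIs? H f S
  perCopy : ∀ S → ι N * 𝟙 (isCopy? {n} H S) (weight P S) ≤ ∑ (overVec n (verts H)) (λ f → 𝟙 (embeds? S f) (weight P S))
  perCopy S with isCopy? {n} H S
  ... | no _ = subst (_≤ _) (sym (*-zeroʳ (ι N)))
    (∑-nonneg (overVec n (verts H)) (λ f → 𝟙-nonneg (embeds? S f) (weight-nonneg P S)))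
  ... | yes (f , embeds) with automorphisms f S embeds
  ...   | L , unique , len , all =
    subst (λ i → ι i * weight P S ≤ ∑ (overVec n (verts H)) (λ g → 𝟙 (embeds? S g) (weight P S))) len
      (count≤∑V (λ g → 𝟙-nonneg (embeds? S g) (weight-nonneg P S)) unique
        (All.map (λ {g} emb′ → ≤-reflexive (sym (𝟙-yes (embeds? S g) emb′))) all))

permute : ∀ {A : Set} {k} → (Fin k → Fin k) → Vec A k → Vec A k
permute σ f = Vec.tabulate (λ i → lookup f (σ i))

lookup-permute : ∀ {A : Set} {k} (σ : Fin k → Fin k) (f : Vec A k) i → lookup (permute σ f) i ≡ lookup f (σ i)
lookup-permute σ f i = lookup∘tabulate (λ i → lookup f (σ i)) i

-- Edges of a `Graph` are indexed oriented pairs. The induced map on the indices is therefore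
-- recorded, it may reverse an edge, and `preimage` shows that every edge of the image is still
-- covered.
record Automorphism (H : Graph) : Set where
  field
    onVerts   : Fin (verts H) → Fin (verts H)
    injective : ∀ i j → onVerts i ≡ onVerts j → i ≡ j
    onEdges   : Fin (nE H) → Fin (nE H)
    preimage  : Fin (nE H) → Fin (nE H)
    onto      : ∀ h → onEdges (preimage h) ≡ h
    ends-at   : ∀ h →
      (onVerts (proj₁ (edge H h)) ≡ proj₁ (edge H (onEdges h)) × onVerts (proj₂ (edge H h)) ≡ proj₂ (edge H (onEdges h)))
      ⊎ (onVerts (proj₁ (edge H h)) ≡ proj₂ (edge H (onEdges h)) × onVerts (proj₂ (edge H h)) ≡ proj₁ (edge H (onEdges h)))
open Automorphism

embeds-permute : ∀ {n} H (σ : Automorphism H) (S : Vec Bool (nEdges n)) (f : Vec (Fin n) (verts H)) →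
  Embeds H S f → Embeds H S (permute (onVerts σ) f)
embeds-permute {n} H σ S f (f-inj , image) = inj , image′
  where
  g = permute (onVerts σ) f
  g≡ : ∀ i → lookup g i ≡ lookup f (onVerts σ i)
  g≡ = lookup-permute (onVerts σ) f
  inj : Injective g
  inj i j eq = injective σ i j (f-inj _ _ (trans (sym (g≡ i)) (trans eq (g≡ j))))
  move : ∀ {a b a′ b′ x y} → (onVerts σ a ≡ a′ × onVerts σ b ≡ b′) ⊎ (onVerts σ a ≡ b′ × onVerts σ b ≡ a′) →
    (lookup g a ≡ x × lookup g b ≡ y) ⊎ (lookup g a ≡ y × lookup g b ≡ x) →
    (lookup f a′ ≡ x × lookup f b′ ≡ y) ⊎ (lookup f a′ ≡ y × lookup f b′ ≡ x)
  move {a} {b} (inj₁ (refl , refl)) (inj₁ (p , q)) = inj₁ (trans (sym (g≡ a)) p , trans (sym (g≡ b)) q)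
  move {a} {b} (inj₁ (refl , refl)) (inj₂ (p , q)) = inj₂ (trans (sym (g≡ a)) p , trans (sym (g≡ b)) q)
  move {a} {b} (inj₂ (refl , refl)) (inj₁ (p , q)) = inj₂ (trans (sym (g≡ b)) q , trans (sym (g≡ a)) p)
  move {a} {b} (inj₂ (refl , refl)) (inj₂ (p , q)) = inj₁ (trans (sym (g≡ b)) q , trans (sym (g≡ a)) p)
  unmove : ∀ {a b a′ b′ x y} → (onVerts σ a ≡ a′ × onVerts σ b ≡ b′) ⊎ (onVerts σ a ≡ b′ × onVerts σ b ≡ a′) →
    (lookup f a′ ≡ x × lookup f b′ ≡ y) ⊎ (lookup f a′ ≡ y × lookup f b′ ≡ x) →
    (lookup g a ≡ x × lookup g b ≡ y) ⊎ (lookup g a ≡ y × lookup g b ≡ x)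
  unmove {a} {b} (inj₁ (refl , refl)) (inj₁ (p , q)) = inj₁ (trans (g≡ a) p , trans (g≡ b) q)
  unmove {a} {b} (inj₁ (refl , refl)) (inj₂ (p , q)) = inj₂ (trans (g≡ a) p , trans (g≡ b) q)
  unmove {a} {b} (inj₂ (refl , refl)) (inj₁ (p , q)) = inj₂ (trans (g≡ a) q , trans (g≡ b) p)
  unmove {a} {b} (inj₂ (refl , refl)) (inj₂ (p , q)) = inj₁ (trans (g≡ a) q , trans (g≡ b) p)
  image′ : ImageIs H g S
  image′ e = (λ Se → covered (proj₁ (image e) Se)) , (λ (h , hits) → proj₂ (image e) (onEdges σ h , move (ends-at σ h) hits))
    where
    covered : (∃ λ h → Hits H f h e) → ∃ λ h → Hits H g h e
    covered (h , hits) =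
      preimage σ h , unmove (ends-at σ (preimage σ h)) (subst (λ h → Hits H f h e) (sym (onto σ h)) hits)

-- Symmetries of paths and cycles

opposite-inject₁ : ∀ {k} (i : Fin k) → opposite (inject₁ i) ≡ suc (opposite i)
opposite-inject₁ zero    = refl
opposite-inject₁ (suc i) = cong inject₁ (opposite-inject₁ i)

opposite-injective : ∀ {k} (i j : Fin k) → opposite i ≡ opposite j → i ≡ j
opposite-injective i j eq = trans (sym (opposite-involutive i)) (trans (cong opposite eq) (opposite-involutive j))

opposite-fromℕ : ∀ k → opposite (fromℕ k) ≡ zero
opposite-fromℕ k = opposite-involutive {suc k} zero

inject₁≢suc : ∀ {k} (i : Fin k) → inject₁ i ≢ suc i
inject₁≢suc (suc i) eq = inject₁≢suc i (suc-injective eq)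

no-2-cycle : ∀ {k} (i j : Fin k) → inject₁ i ≡ suc j → suc i ≡ inject₁ j → ⊥
no-2-cycle (suc i) (suc j) p q = no-2-cycle i j (suc-injective p) (suc-injective q)

path-simple : ∀ k → Simple (Path (suc k))
path-simple k = record { loopless = inject₁≢suc ; distinct = distinct′ }
  where
  distinct′ : ∀ h h′ → SameEdge (Path (suc k)) h h′ → h ≡ h′
  distinct′ h h′ (inj₁ (_ , eq)) = suc-injective eq
  distinct′ h h′ (inj₂ (p , q))  = ⊥-elim (no-2-cycle h h′ p q)

path-reversal : ∀ k → Automorphism (Path (suc k))
path-reversal k = record
  { onVerts = opposite ; injective = opposite-injective ; onEdges = opposite ; preimage = opposite
  ; onto = opposite-involutive ; ends-at = λ h → inj₂ (opposite-inject₁ h , refl) }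

path-automorphisms : ∀ {n} k (f : Vec (Fin n) (suc (suc k))) S → Embeds (Path (suc (suc k))) S f →
  ∃ λ L → Unique L × length L ≡ 2 × All (Embeds (Path (suc (suc k))) S) L
path-automorphisms k f S emb =
  f ∷ permute opposite f ∷ [] , ((distinct′ ∷ []) ∷ [] ∷ []) , refl ,
  emb ∷ embeds-permute (Path (suc (suc k))) (path-reversal (suc k)) S f emb ∷ []
  where
  distinct′ : f ≢ permute opposite f
  distinct′ eq with proj₁ emb zero (fromℕ (suc k)) (trans (cong (λ g → lookup g zero) eq) (lookup-permute opposite f zero))
  ... | ()

prev : ∀ {k} → Fin (suc k) → Fin (suc k)
prev {k} zero    = fromℕ k
prev     (suc i) = inject₁ i

cycle-edge : ∀ k h → edge (Cycle (suc k)) h ≡ (prev h , h)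
cycle-edge k zero    = refl
cycle-edge k (suc h) = refl

-- The dihedral relation: conjugation by the reflection inverts the rotation. It provides the
-- inverse `next` and the action of the reflection on edges.
prev-opposite-prev : ∀ {k} (i : Fin (suc k)) → prev (opposite (prev i)) ≡ opposite i
prev-opposite-prev {k} zero    = cong prev (opposite-fromℕ k)
prev-opposite-prev     (suc i) = cong prev (opposite-inject₁ i)

next : ∀ {k} → Fin (suc k) → Fin (suc k)
next i = opposite (prev (opposite i))

prev-next : ∀ {k} (i : Fin (suc k)) → prev (next i) ≡ i
prev-next i = trans (prev-opposite-prev (opposite i)) (opposite-involutive i)

next-prev : ∀ {k} (i : Fin (suc k)) → next (prev i) ≡ i
next-prev i = trans (cong opposite (prev-opposite-prev i)) (opposite-involutive i)

prev-injective : ∀ {k} (i j : Fin (suc k)) → prev i ≡ prev j → i ≡ j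
prev-injective i j eq = trans (sym (next-prev i)) (trans (cong next eq) (next-prev j))

-- This is where a cycle has at least three vertices: the lemma excludes loops and double edges and
-- separates rotations from reflections.
prev-prev≢ : ∀ {k} (i : Fin (3 ℕ.+ k)) → prev (prev i) ≢ i
prev-prev≢ zero          ()
prev-prev≢ (suc zero)    ()
prev-prev≢ (suc (suc i)) eq =
  ℕₚ.<⇒≢ (ℕₚ.m≤n⇒m≤1+n ℕₚ.≤-refl) (trans (sym (trans (toℕ-inject₁ (inject₁ i)) (toℕ-inject₁ i))) (cong toℕ eq))

prev≢ : ∀ {k} (i : Fin (3 ℕ.+ k)) → prev i ≢ i
prev≢ i eq = prev-prev≢ i (trans (cong prev eq) eq)

cycle-simple : ∀ k → Simple (Cycle (3 ℕ.+ k))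
cycle-simple k = record { loopless = loopless′ ; distinct = distinct′ }
  where
  H = Cycle (3 ℕ.+ k)
  loopless′ : ∀ h → proj₁ (edge H h) ≢ proj₂ (edge H h)
  loopless′ h rewrite cycle-edge (2 ℕ.+ k) h = prev≢ h
  distinct′ : ∀ h h′ → SameEdge H h h′ → h ≡ h′
  distinct′ h h′ same rewrite cycle-edge (2 ℕ.+ k) h | cycle-edge (2 ℕ.+ k) h′ with same
  ... | inj₁ (_ , eq) = eq
  ... | inj₂ (p , q)  = ⊥-elim (prev-prev≢ h′ (trans (cong prev (sym q)) p))

cycle-rotation : ∀ k → Automorphism (Cycle (suc k))
cycle-rotation k = record
  { onVerts = prev ; injective = prev-injective ; onEdges = prev ; preimage = next ; onto = prev-next
  ; ends-at = ends-at′ }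
  where
  H = Cycle (suc k)
  ends-at′ : ∀ h →
    (prev (proj₁ (edge H h)) ≡ proj₁ (edge H (prev h)) × prev (proj₂ (edge H h)) ≡ proj₂ (edge H (prev h)))
    ⊎ (prev (proj₁ (edge H h)) ≡ proj₂ (edge H (prev h)) × prev (proj₂ (edge H h)) ≡ proj₁ (edge H (prev h)))
  ends-at′ h rewrite cycle-edge k h | cycle-edge k (prev h) = inj₁ (refl , refl)

cycle-reflection : ∀ k → Automorphism (Cycle (suc k))
cycle-reflection k = record
  { onVerts = opposite ; injective = opposite-injective ; onEdges = λ h → opposite (prev h)
  ; preimage = λ h → next (opposite h)
  ; onto = λ h → trans (cong opposite (prev-next (opposite h))) (opposite-involutive h)
  ; ends-at = ends-at′ }
  where
  H = Cycle (suc k)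
  ends-at′ : ∀ h →
    (opposite (proj₁ (edge H h)) ≡ proj₁ (edge H (opposite (prev h))) × opposite (proj₂ (edge H h)) ≡ proj₂ (edge H (opposite (prev h))))
    ⊎ (opposite (proj₁ (edge H h)) ≡ proj₂ (edge H (opposite (prev h))) × opposite (proj₂ (edge H h)) ≡ proj₁ (edge H (opposite (prev h))))
  ends-at′ h rewrite cycle-edge k h | cycle-edge k (opposite (prev h)) = inj₂ (refl , sym (prev-opposite-prev h))

back : ∀ {k} → ℕ → Fin (suc k) → Fin (suc k)
back zero    i = i
back (suc j) i = back j (prev i)

prev-back : ∀ {k} j (i : Fin (suc k)) → prev (back j i) ≡ back j (prev i)
prev-back zero    i = refl
prev-back (suc j) i = prev-back j (prev i)

toℕ-back : ∀ {k} j (i : Fin (suc k)) → j ℕ.≤ toℕ i → toℕ (back j i) ≡ toℕ i ℕ.∸ j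
toℕ-back zero    i       _             = refl
toℕ-back (suc j) (suc i) (ℕ.s≤s j≤i) =
  trans (toℕ-back j (inject₁ i) (subst (j ℕ.≤_) (sym (toℕ-inject₁ i)) j≤i)) (cong (ℕ._∸ j) (toℕ-inject₁ i))

rotate : ∀ {A : Set} {k} → ℕ → Vec A (suc k) → Vec A (suc k)
rotate zero    f = f
rotate (suc j) f = rotate j (permute prev f)

lookup-rotate : ∀ {A : Set} {k} j (f : Vec A (suc k)) i → lookup (rotate j f) i ≡ lookup f (back j i)
lookup-rotate zero    f i = refl
lookup-rotate (suc j) f i =
  trans (lookup-rotate j (permute prev f) i)
        (trans (lookup-permute prev f (back j i)) (cong (lookup f) (prev-back j i)))

embeds-rotate : ∀ {n} k j S (f : Vec (Fin n) (suc k)) → Embeds (Cycle (suc k)) S f → Embeds (Cycle (suc k)) S (rotate j f)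
embeds-rotate k zero    S f emb = emb
embeds-rotate k (suc j) S f emb =
  embeds-rotate k j S (permute prev f) (embeds-permute (Cycle (suc k)) (cycle-rotation k) S f emb)

rotations : ∀ {A : Set} {k} → Vec A (suc k) → List (Vec A (suc k))
rotations {k = k} f = List.tabulate {n = suc k} (λ j → rotate (toℕ j) f)

-- Rotations are told apart by their value at the last position: going back j ≤ k steps from there
-- never wraps around and ends at k - j.
rotations-unique : ∀ {n k} (f : Vec (Fin n) (suc k)) → Injective f → Unique (rotations f)
rotations-unique {k = k} f f-inj = Uniqueₚ.tabulate⁺ (λ {i} {j} eq →
  toℕ-injective (ℕₚ.∸-cancelˡ-≡ (bound i) (bound j)
    (trans (sym (position i)) (trans (cong toℕ (same i j eq)) (position j)))))
  where
  bound : ∀ (j : Fin (suc k)) → toℕ j ℕ.≤ k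
  bound j = ℕ.s≤s⁻¹ (toℕ<n j)
  position : ∀ j → toℕ (back (toℕ j) (fromℕ k)) ≡ k ℕ.∸ toℕ j
  position j = trans (toℕ-back (toℕ j) (fromℕ k) (subst (toℕ j ℕ.≤_) (sym (toℕ-fromℕ k)) (bound j)))
                     (cong (ℕ._∸ toℕ j) (toℕ-fromℕ k))
  same : ∀ i j → rotate (toℕ i) f ≡ rotate (toℕ j) f → back (toℕ i) (fromℕ k) ≡ back (toℕ j) (fromℕ k)
  same i j eq = f-inj _ _ (trans (sym (lookup-rotate (toℕ i) f (fromℕ k)))
    (trans (cong (λ g → lookup g (fromℕ k)) eq) (lookup-rotate (toℕ j) f (fromℕ k))))

-- Rotations commute with `prev` whereas the reflection inverts it; if the two sequences agreed, the
-- square of `prev` would fix a vertex.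
rotation≢reflection : ∀ {n k} (f : Vec (Fin n) (3 ℕ.+ k)) → Injective f → ∀ i j →
  rotate i f ≢ rotate j (permute opposite f)
rotation≢reflection {k = k} f f-inj i j eq = prev-prev≢ (opposite y) (begin
  prev (prev (opposite y))      ≡⟨ cong (λ z → prev (prev z)) (sym (agree zero)) ⟩
  prev (prev (back i zero))     ≡⟨ cong prev (prev-back i zero) ⟩
  prev (back i (prev zero))     ≡⟨ cong prev (agree (prev zero)) ⟩
  prev (opposite (back j (prev zero))) ≡⟨ cong (λ z → prev (opposite z)) (sym (prev-back j zero)) ⟩
  prev (opposite (prev y))      ≡⟨ prev-opposite-prev y ⟩
  opposite y                    ∎)
  where
  open ≡-Reasoning
  y : Fin (3 ℕ.+ k)
  y = back j zero
  agree : ∀ h → back i h ≡ opposite (back j h)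
  agree h = f-inj _ _ (trans (sym (lookup-rotate i f h)) (trans (cong (λ g → lookup g h) eq)
    (trans (lookup-rotate j (permute opposite f) h) (lookup-permute opposite f (back j h)))))

cycle-automorphisms : ∀ {n} k (f : Vec (Fin n) (3 ℕ.+ k)) S → Embeds (Cycle (3 ℕ.+ k)) S f →
  ∃ λ L → Unique L × length L ≡ (3 ℕ.+ k) ℕ.+ (3 ℕ.+ k) × All (Embeds (Cycle (3 ℕ.+ k)) S) L
cycle-automorphisms k f S emb =
  rotations f ++ rotations g ,
  Uniqueₚ.++⁺ (rotations-unique f (proj₁ emb)) (rotations-unique g (proj₁ emb′)) disjoint ,
  trans (length-++ (rotations f)) (cong₂ ℕ._+_ (length-tabulate (λ (j : Fin (3 ℕ.+ k)) → rotate (toℕ j) f))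
                                               (length-tabulate (λ (j : Fin (3 ℕ.+ k)) → rotate (toℕ j) g))) ,
  Allₚ.++⁺ (Allₚ.tabulate⁺ {f = λ (j : Fin (3 ℕ.+ k)) → rotate (toℕ j) f} (λ j → embeds-rotate (2 ℕ.+ k) (toℕ j) S f emb))
           (Allₚ.tabulate⁺ {f = λ (j : Fin (3 ℕ.+ k)) → rotate (toℕ j) g} (λ j → embeds-rotate (2 ℕ.+ k) (toℕ j) S g emb′))
  where
  g = permute opposite f
  emb′ = embeds-permute (Cycle (3 ℕ.+ k)) (cycle-reflection (2 ℕ.+ k)) S f emb
  disjoint : ∀ {v} → (v ∈ rotations f) × (v ∈ rotations g) → ⊥
  disjoint (v∈f , v∈g) with ∈-tabulate⁻ {f = λ (j : Fin (3 ℕ.+ k)) → rotate (toℕ j) f} v∈f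
                         | ∈-tabulate⁻ {f = λ (j : Fin (3 ℕ.+ k)) → rotate (toℕ j) g} v∈g
  ... | i , refl | j , eq = rotation≢reflection f (proj₁ emb) (toℕ i) (toℕ j) eq

open import Data.Integer using (+_)

fresh≡1 : ∀ {n k} (y : Fin n) (v : Vec (Fin n) k) → (∀ i → y ≢ lookup v i) → fresh y v ≡ 1ℚ
fresh≡1 y []       _   = refl
fresh≡1 y (x ∷ xs) y∉v with δ-cases y x
... | inj₁ (eq , _) = ⊥-elim (y∉v zero eq)
... | inj₂ (_ , eq) = cong₂ _*_ (cong (λ d → 1ℚ - d) eq) (fresh≡1 y xs (λ i → y∉v (suc i)))

lookup-fromℕ : ∀ {A : Set} {k} (v : Vec A (suc k)) → lookup v (fromℕ k) ≡ endpt v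
lookup-fromℕ (x ∷ [])     = refl
lookup-fromℕ (_ ∷ y ∷ ys) = lookup-fromℕ (y ∷ ys)

lookup-zero : ∀ {A : Set} {k} (v : Vec A (suc k)) → lookup v zero ≡ head v
lookup-zero (x ∷ xs) = refl

ends-distinct : ∀ n e → proj₁ (ends n e) ≢ proj₂ (ends n e)
ends-distinct (suc n) e eq with splitAt n e
ends-distinct (suc n) e () | inj₁ i
... | inj₂ e′ = ends-distinct n e′ (suc-injective eq)

-- Numerical estimates

ι≡/1 : ∀ n → ι n ≡ + n / 1
ι≡/1 zero    = refl
ι≡/1 (suc n) = trans (cong (λ t → 1ℚ + t) (ι≡/1 n)) (toℚᵘ-injective (begin
  toℚᵘ (1ℚ + (+ n / 1))             ≈⟨ toℚᵘ-homo-+ 1ℚ (+ n / 1) ⟩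
  toℚᵘ 1ℚ ℚᵘ.+ toℚᵘ (+ n / 1)       ≈⟨ ℚᵘₚ.+-congʳ (toℚᵘ 1ℚ) (toℚᵘ-fromℚᵘ (ℚᵘ.mkℚᵘ (+ n) 0)) ⟩
  toℚᵘ 1ℚ ℚᵘ.+ ℚᵘ.mkℚᵘ (+ n) 0      ≈⟨ ℚᵘ.*≡* (cong (ℤ._* + 1) (cong (λ t → + 1 ℤ.+ t) (ℤₚ.*-identityʳ (+ n)))) ⟩
  ℚᵘ.mkℚᵘ (+ suc n) 0               ≈⟨ ℚᵘₚ.≃-sym (toℚᵘ-fromℚᵘ (ℚᵘ.mkℚᵘ (+ suc n) 0)) ⟩
  toℚᵘ (+ suc n / 1)                ∎))
  where open ℚᵘₚ.≃-Reasoning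

/-*-cancel : ∀ c d .{{_ : ℕ.NonZero d}} → (+ c / d) * ι d ≡ ι c
/-*-cancel c d@(suc d-1) = trans (cong (λ t → (+ c / d) * t) (ι≡/1 d)) (trans (toℚᵘ-injective (begin
  toℚᵘ ((+ c / d) * (+ d / 1))               ≈⟨ toℚᵘ-homo-* (+ c / d) (+ d / 1) ⟩
  toℚᵘ (+ c / d) ℚᵘ.* toℚᵘ (+ d / 1)
    ≈⟨ ℚᵘₚ.*-cong (toℚᵘ-fromℚᵘ (ℚᵘ.mkℚᵘ (+ c) d-1)) (toℚᵘ-fromℚᵘ (ℚᵘ.mkℚᵘ (+ d) 0)) ⟩
  ℚᵘ.mkℚᵘ (+ c) d-1 ℚᵘ.* ℚᵘ.mkℚᵘ (+ d) 0
    ≈⟨ ℚᵘ.*≡* (trans (ℤₚ.*-identityʳ (+ c ℤ.* + d))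
         (cong (λ t → + c ℤ.* + t) (sym (ℕₚ.*-identityʳ d)))) ⟩
  ℚᵘ.mkℚᵘ (+ c) 0                            ≈⟨ ℚᵘₚ.≃-sym (toℚᵘ-fromℚᵘ (ℚᵘ.mkℚᵘ (+ c) 0)) ⟩
  toℚᵘ (+ c / 1)                             ∎)) (sym (ι≡/1 c)))
  where open ℚᵘₚ.≃-Reasoning

ι-+ : ∀ a b → ι (a ℕ.+ b) ≡ ι a + ι b
ι-+ zero    b = sym (+-identityˡ (ι b))
ι-+ (suc a) b = trans (cong (λ t → 1ℚ + t) (ι-+ a b)) (sym (+-assoc 1ℚ (ι a) (ι b)))

ι-* : ∀ a b → ι (a ℕ.* b) ≡ ι a * ι b
ι-* zero    b = sym (*-zeroˡ (ι b))
ι-* (suc a) b = trans (ι-+ b (a ℕ.* b)) (trans (cong (λ t → ι b + t) (ι-* a b)) (distrib (ι a) (ι b)))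
  where distrib : ∀ a b → b + a * b ≡ (1ℚ + a) * b
        distrib = solve-∀ ℚ-ring

ι-^ : ∀ a k → ι (a ℕ.^ k) ≡ pow (ι a) k
ι-^ a zero    = +-identityʳ 1ℚ
ι-^ a (suc k) = trans (ι-* a (a ℕ.^ k)) (cong (λ t → ι a * t) (ι-^ a k))

-- For a variable index the normalised fraction `over` does not compute; clearing its denominator
-- makes comparisons possible.
over-* : ∀ c k → over c (suc k) * (ι 10 * pow (ι (suc k)) k) ≡ ι c
over-* c k = trans
  (cong (λ t → over c (suc k) * t) (sym (trans (ι-* 10 (suc k ℕ.^ k)) (cong (λ t → ι 10 * t) (ι-^ (suc k) k)))))
  (/-*-cancel c (10 ℕ.* (suc k ℕ.^ k)) {{ℕₚ.m*n≢0 10 (suc k ℕ.^ k) {{_}} {{ℕₚ.m^n≢0 (suc k) k}}}})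

pow-* : ∀ x y n → pow (x * y) n ≡ pow x n * pow y n
pow-* x y zero    = refl
pow-* x y (suc n) = trans (cong (λ t → x * y * t) (pow-* x y n)) (shuffle x y (pow x n) (pow y n))
  where shuffle : ∀ x y p q → x * y * (p * q) ≡ x * p * (y * q)
        shuffle = solve-∀ ℚ-ring

-- (1 + 1/N)^(N + 1) with N = n + 1, which decreases to e.
euler : ℕ → ℚ
euler n = pow (1ℚ + recip n) (2 ℕ.+ n)

-- Put u = 1/(n + 1), v = 1/(n + 2), x = 1 + u, y = 1 + v. The tangent at y bounds xⁿ⁺² below by
-- yⁿ⁺¹((n + 2)x - (n + 1)y). The last factor is 1 + v + u, which is at least y² because u = v + uv
-- ≥ v + v².
euler-antitone : ∀ n → euler (suc n) ≤ euler n
euler-antitone n = ≤-trans (subst (_≤ p * ((1ℚ + M) * x - M * y)) (assoc y p) (*-monoˡ 0≤p y²≤))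
  (≤-by-slack _ (tangent 0≤x 0≤y (suc n)) (collect x y M p (pow x (2 ℕ.+ n))))
  where
  u v M x y p : ℚ
  u = recip n
  v = recip (suc n)
  M = ι (suc n)
  x = 1ℚ + u
  y = 1ℚ + v
  p = pow y (suc n)
  0≤x = +-nonneg 0≤1 (recip-nonneg n)
  0≤y = +-nonneg 0≤1 (recip-nonneg (suc n))
  0≤p = pow-nonneg 0≤y (suc n)
  assoc : ∀ y p → p * (y * y) ≡ y * (y * p)
  assoc = solve-∀ ℚ-ring
  collect : ∀ x y M p q → p * ((1ℚ + M) * x - M * y) + (q + M * (y * p) - (1ℚ + M) * (x * p)) ≡ q
  collect = solve-∀ ℚ-ring
  u≡v+uv : u ≡ v + u * v
  u≡v+uv = trans (sym (trans (cong (λ t → u * t) (ι-recip (suc n))) (*-identityʳ u)))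
    (trans (expand u v M) (trans (cong (λ t → t * v + u * v) (ι-recip n)) (cong (λ t → t + u * v) (*-identityˡ v))))
    where expand : ∀ u v M → u * ((1ℚ + M) * v) ≡ M * u * v + u * v
          expand = solve-∀ ℚ-ring
  v≤u : v ≤ u
  v≤u = ≤-by-slack (u * v) (*-nonneg (recip-nonneg n) (recip-nonneg (suc n))) (sym u≡v+uv)
  v+v²≤u : v + v * v ≤ u
  v+v²≤u = subst (v + v * v ≤_) (sym u≡v+uv) (+-monoʳ-≤ v (*-monoʳ (recip-nonneg (suc n)) v≤u))
  rhs : (1ℚ + M) * x - M * y ≡ 1ℚ + v + u
  rhs = trans (open-up u v M) (trans (cong₂ (λ s t → 1ℚ + v + u + (s - t)) (ι-recip n) (ι-recip (suc n)))
                                     (+-identityʳ (1ℚ + v + u)))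
    where
    open-up : ∀ u v M → (1ℚ + M) * (1ℚ + u) - M * (1ℚ + v) ≡ 1ℚ + v + u + (M * u - (1ℚ + M) * v)
    open-up = solve-∀ ℚ-ring
  y²≤ : y * y ≤ (1ℚ + M) * x - M * y
  y²≤ = subst₂ _≤_ (square v) (sym rhs) (+-monoʳ-≤ (1ℚ + v) v+v²≤u)
    where square : ∀ v → 1ℚ + v + (v + v * v) ≡ (1ℚ + v) * (1ℚ + v)
          square = solve-∀ ℚ-ring

euler≤3 : ∀ n → euler (4 ℕ.+ n) ≤ ι 3
-- (6/5)^6 is the first value below 3; the preceding one, (5/4)^5, exceeds it.
euler≤3 zero    = from-yes (euler 4 ≤? ι 3)
euler≤3 (suc n) = ≤-trans (euler-antitone (4 ℕ.+ n)) (euler≤3 n)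

compound≤3 : ∀ n → pow (1ℚ + recip (3 ℕ.+ n)) (4 ℕ.+ n) ≤ ι 3
-- Here the dominating value would be (5/4)^5 > 3, so (5/4)^4 is checked directly.
compound≤3 zero    = from-yes (pow (1ℚ + recip 3) 4 ≤? ι 3)
compound≤3 (suc n) =
  ≤-trans (subst (_≤ euler (4 ℕ.+ n)) (*-identityˡ p)
            (*-monoʳ (pow-nonneg (+-nonneg 0≤1 (recip-nonneg (4 ℕ.+ n))) (5 ℕ.+ n))
              (≤-by-slack {1ℚ} (recip (4 ℕ.+ n)) (recip-nonneg (4 ℕ.+ n)) refl)))
          (euler≤3 n)
  where p = pow (1ℚ + recip (4 ℕ.+ n)) (5 ℕ.+ n)

κΨ<over : ∀ n → κ * Ψ (2 ℕ.+ n) 1ℚ < over 27 (5 ℕ.+ n)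
κΨ<over n = *-cancelʳ-<-nonNeg D {{nonNegative 0≤D}} (begin-strict
  κ * Ψ (2 ℕ.+ n) 1ℚ * D
    ≡⟨ cong (λ t → κ * pow t (4 ℕ.+ n) * D) (*-identityˡ r) ⟩
  κ * pow r (4 ℕ.+ n) * (ι 10 * pow (ι (5 ℕ.+ n)) (4 ℕ.+ n))
    ≡⟨ regroup κ (pow r (4 ℕ.+ n)) (ι 10) (pow (ι (5 ℕ.+ n)) (4 ℕ.+ n)) ⟩
  κ * ι 10 * (pow (ι (5 ℕ.+ n)) (4 ℕ.+ n) * pow r (4 ℕ.+ n))
    ≡⟨ cong (λ t → κ * ι 10 * t) (trans (sym (pow-* (ι (5 ℕ.+ n)) r (4 ℕ.+ n))) (cong (λ t → pow t (4 ℕ.+ n)) ratio)) ⟩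
  κ * ι 10 * pow (1ℚ + r) (4 ℕ.+ n)
    ≤⟨ *-monoˡ (from-yes (0ℚ ≤? κ * ι 10)) (compound≤3 n) ⟩
  κ * ι 10 * ι 3
    -- The left side is 80/9 · 3 = 80/3, which is what the constant 2.7 leaves room for.
    <⟨ from-yes (κ * ι 10 * ι 3 <? ι 27) ⟩
  ι 27
    ≡⟨ sym (over-* 27 (4 ℕ.+ n)) ⟩
  over 27 (5 ℕ.+ n) * D ∎)
  where
  open ≤-Reasoning
  r D : ℚ
  r = recip (3 ℕ.+ n)
  D = ι 10 * pow (ι (5 ℕ.+ n)) (4 ℕ.+ n)
  0≤D = *-nonneg (ι-nonneg 10) (pow-nonneg (ι-nonneg (5 ℕ.+ n)) (4 ℕ.+ n))
  regroup : ∀ c p t q → c * p * (t * q) ≡ c * t * (q * p)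
  regroup = solve-∀ ℚ-ring
  ratio : ι (5 ℕ.+ n) * r ≡ 1ℚ + r
  ratio = trans (expand (ι (4 ℕ.+ n)) r) (cong (λ t → t + r) (ι-recip (3 ℕ.+ n)))
    where expand : ∀ a r → (1ℚ + a) * r ≡ a * r + r
          expand = solve-∀ ℚ-ring

-- Upper bounds for edge probability measures

module _ {n : ℕ} (P : EdgeProb n) where
  open Walks (pairMass P) (pairMass-nonneg P) (pairMass-sym P) (pairMass-total P)

  path-weight : ∀ {k} (f : Vec (Fin n) (suc k)) → Injective f → embeddingWeight P (Path (suc k)) f ≡ ψ f
  path-weight (x ∷ [])     _     = refl
  path-weight {suc k} (y ∷ x ∷ xs) f-inj =
    cong₂ _*_
      (trans (sym (*-identityˡ (pairMass P y x)))
             (cong (_* pairMass P y x) (sym (fresh≡1 y (x ∷ xs) (λ i eq → case-zero (f-inj zero (suc i) eq))))))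
      (path-weight (x ∷ xs) (λ i j eq → suc-injective (f-inj (suc i) (suc j) eq)))
    where
    case-zero : ∀ {i : Fin (suc k)} → Fin.zero ≢ suc i
    case-zero ()

  2β-path≤ : ∀ k → ι 2 * β P (Path (2 ℕ.+ k)) ≤ ∑V (2 ℕ.+ k) ψ
  2β-path≤ k = count-copies P (path-simple (suc k)) 2 (path-automorphisms k) ψ-nonneg
    (λ f f-inj → ≤-reflexive (path-weight f f-inj))

  cycle-weight : ∀ {k} (f : Vec (Fin n) (suc k)) → Injective f →
    embeddingWeight P (Cycle (suc k)) f ≡ ψ f * pairMass P (head f) (endpt f)
  cycle-weight f f-inj =
    trans (cong₂ _*_ (trans (cong₂ (pairMass P) (lookup-fromℕ f) (lookup-zero f))
                            (pairMass-sym P (endpt f) (head f)))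
                     (path-weight f f-inj))
          (*-comm (pairMass P (head f) (endpt f)) (ψ f))

  2mβ-cycle≤ : ∀ k → ι ((3 ℕ.+ k) ℕ.+ (3 ℕ.+ k)) * β P (Cycle (3 ℕ.+ k)) ≤ cycles (2 ℕ.+ k)
  2mβ-cycle≤ k = count-copies P (cycle-simple k) ((3 ℕ.+ k) ℕ.+ (3 ℕ.+ k)) (cycle-automorphisms k)
    (λ f → *-nonneg (ψ-nonneg f) (pairMass-nonneg P (head f) (endpt f)))
    (λ f f-inj → ≤-reflexive (cycle-weight f f-inj))

  Fm≤walks : ∀ k → Fm (3 ℕ.+ k) P ≤ ½ * ∑V (4 ℕ.+ k) ψ + cycles (2 ℕ.+ k)
  Fm≤walks k = subst (_≤ ½ * ∑V (4 ℕ.+ k) ψ + cycles (2 ℕ.+ k)) eq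
    (+-mono-≤ (*-monoˡ 0≤½ (2β-path≤ (2 ℕ.+ k))) (2mβ-cycle≤ k))
    where
    halve : ∀ p → ½ * ((1ℚ + (1ℚ + 0ℚ)) * p) ≡ p
    halve = solve-∀ ℚ-ring
    double : (3 ℕ.+ k) ℕ.+ (3 ℕ.+ k) ≡ 2 ℕ.* (3 ℕ.+ k)
    double = cong (λ t → (3 ℕ.+ k) ℕ.+ t) (sym (ℕₚ.+-identityʳ (3 ℕ.+ k)))
    eq : ½ * (ι 2 * β P (Path (4 ℕ.+ k))) + ι ((3 ℕ.+ k) ℕ.+ (3 ℕ.+ k)) * β P (Cycle (3 ℕ.+ k)) ≡ Fm (3 ℕ.+ k) P
    eq = trans (cong₂ (λ p c → p + c * β P (Cycle (3 ℕ.+ k))) (halve (β P (Path (4 ℕ.+ k))))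
                      (trans (cong ι double) (ι≡/1 (2 ℕ.* (3 ℕ.+ k)))))
               (+-comm (β P (Path (4 ℕ.+ k))) ((+ (2 ℕ.* (3 ℕ.+ k)) / 1) * β P (Cycle (3 ℕ.+ k))))

  Fm≤κΨ : ∀ k → Fm (3 ℕ.+ k) P ≤ κ * Ψ k 1ℚ
  Fm≤κΨ k = ≤-trans (Fm≤walks k) (paths+cycles≤Ψ k)

  F₄≤ : Fm 4 P ≤ over 20 4
  F₄≤ = ≤-trans (Fm≤walks 1) paths+4-cycles≤

  sumSq : ℚ
  sumSq = ΣFin (nEdges n) (λ e → μ P e * μ P e)

  sumSqSupp≤ : sumSqSupp P ≤ sumSq
  sumSqSupp≤ = ΣFin-mono (nEdges n) (λ e → 𝟙≤ (0ℚ <? μ P e) (sq-nonneg (μ P e)))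
    where
    𝟙≤ : ∀ {A : Set} (d : Dec A) {q} → 0ℚ ≤ q → 𝟙 d q ≤ q
    𝟙≤ (yes _) _   = ≤-refl
    𝟙≤ (no _)  0≤q = 0≤q

  sumSq≤1 : sumSq ≤ 1ℚ
  sumSq≤1 = subst (sumSq ≤_) (total P) (ΣFin-mono (nEdges n) (λ e →
    subst (μ P e * μ P e ≤_) (*-identityʳ (μ P e)) (*-monoˡ (nonneg P e) (μ≤1 P e))))

  private
    w v : Fin n → Fin n → ℚ
    w = pairMass P
    v x y = ne x y * w x y

    v-nonneg : ∀ x y → 0ℚ ≤ v x y
    v-nonneg x y = *-nonneg (bit-nonneg (ne-bit x y)) (pairMass-nonneg P x y)

    v≤w : ∀ x y → v x y ≤ w x y
    v≤w x y = subst (v x y ≤_) (*-identityˡ (w x y)) (*-monoʳ (pairMass-nonneg P x y) (bit≤1 (ne-bit x y)))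

    μ≤v : ∀ e x y → x ≢ y → Joins n e x y → μ P e ≤ v x y
    μ≤v e x y x≢y joins with δ-cases x y
    ... | inj₁ (eq , _) = ⊥-elim (x≢y eq)
    ... | inj₂ (_ , eq) = subst (μ P e ≤_)
      (sym (trans (cong (λ d → (1ℚ - d) * w x y) eq) (*-identityˡ (w x y)))) (μ≤pairMass P e x y joins)

    degree≤1 : ∀ x → ΣFin n (v x) ≤ 1ℚ
    degree≤1 x = ≤-trans
      (≤-by-slack (mass (λ z → ne z x * 1ℚ)) (mass-nonneg (λ z → *-nonneg (bit-nonneg (ne-bit z x)) 0≤1))
        (trans (+-comm (ΣFin n (v x)) (mass (λ z → ne z x * 1ℚ)))
               (cong (λ t → mass (λ z → ne z x * 1ℚ) + t) (∑-cong (overFin n) (λ z → cong (_* w x z)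
                 (trans (ne-sym x z) (sym (*-identityʳ (ne z x)))))))))
      (subst (mass (λ z → ne z x * 1ℚ) + ΣFin n (λ z → ne z x * 1ℚ * w x z) ≤_) mass-all
        (mass-delete (λ _ → 1ℚ) x (λ _ → 0≤1) refl))

    Σ₃ : (Fin n → Fin n → Fin n → ℚ) → ℚ
    Σ₃ f = ΣFin n (λ y → ΣFin n (λ x → ΣFin n (f y x)))

  -- The left side is the sum of the squared degrees: the second sum consists of the degenerate
  -- walks that return to their start. Degrees are at most 1 and sum to at most 2.
  cherries : ∑V 3 ψ + ΣFin n (λ y → ΣFin n (λ x → v y x * v x y)) ≤ 2ℚ
  cherries = begin
    ∑V 3 ψ + ΣFin n (λ y → ΣFin n (λ x → v y x * v x y))
      ≡⟨ cong₂ _+_ (∑-cong T (λ (y , x , o) → expand (ne y x) (δ y o) (w y x) (ne x o) (w x o)))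
           (∑-cong (overFin n) (λ y → ∑-cong (overFin n) (λ x → sym (ΣFin-δ y (λ o → v y x * v x o))))) ⟩
    Σ₃ (λ y x o → (1ℚ - δ y o) * (v y x * v x o)) + Σ₃ (λ y x o → δ y o * (v y x * v x o))
      ≡⟨ sym (∑-+ T (λ (y , x , o) → (1ℚ - δ y o) * (v y x * v x o)) (λ (y , x , o) → δ y o * (v y x * v x o))) ⟩
    Σ₃ (λ y x o → (1ℚ - δ y o) * (v y x * v x o) + δ y o * (v y x * v x o))
      ≡⟨ ∑-cong T (λ (y , x , o) → complement (δ y o) (v y x * v x o)) ⟩
    Σ₃ (λ y x o → v y x * v x o)
      ≡⟨ ∑-cong (overFin n) (λ y → ∑-cong (overFin n) (λ x → ΣFin-* n (v y x) (v x))) ⟩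
    ΣFin n (λ y → ΣFin n (λ x → v y x * ΣFin n (v x)))
      ≤⟨ ∑-mono (overFin n) (λ y → ∑-mono (overFin n) (λ x →
           subst (v y x * ΣFin n (v x) ≤_) (*-identityʳ (v y x)) (*-monoˡ (v-nonneg y x) (degree≤1 x)))) ⟩
    ΣFin n (λ y → ΣFin n (λ x → v y x))
      ≤⟨ ∑-mono (overFin n) (λ y → ∑-mono (overFin n) (v≤w y)) ⟩
    ΣFin n (λ y → ΣFin n (λ x → w y x))
      ≡⟨ pairMass-total P ⟩
    2ℚ ∎
    where
    open ≤-Reasoning
    T : Summation (Fin n × Fin n × Fin n)
    T = nested _,_ (overFin n) (nested _,_ (overFin n) (overFin n))
    expand : ∀ a d w b w′ → a * ((1ℚ - d) * 1ℚ) * w * (b * 1ℚ * w′ * 1ℚ) ≡ (1ℚ - d) * (a * w * (b * w′))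
    expand = solve-∀ ℚ-ring
    complement : ∀ d a → (1ℚ - d) * a + d * a ≡ a
    complement = solve-∀ ℚ-ring

  sumSq+sumSq≤ : sumSq + sumSq ≤ ΣFin n (λ y → ΣFin n (λ x → v y x * v x y))
  sumSq+sumSq≤ = begin
    sumSq + sumSq
      ≡⟨ sym (ΣFin-+ (nEdges n) (λ e → μ P e * μ P e) (λ e → μ P e * μ P e)) ⟩
    ΣFin (nEdges n) (λ e → μ P e * μ P e + μ P e * μ P e)
      ≤⟨ ΣFin-mono (nEdges n) perEdge ⟩
    ΣFin (nEdges n) (λ e → μ P e * (g (proj₁ (ends n e)) (proj₂ (ends n e)) + g (proj₂ (ends n e)) (proj₁ (ends n e))))
      ≡⟨ sym (∑-pairMass P g) ⟩
    ΣFin n (λ y → ΣFin n (λ x → g y x * w y x))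
      ≡⟨ ∑-cong (overFin n) (λ y → ∑-cong (overFin n) (λ x → regroup (ne y x) (v x y) (w y x))) ⟩
    ΣFin n (λ y → ΣFin n (λ x → v y x * v x y)) ∎
    where
    open ≤-Reasoning
    g : Fin n → Fin n → ℚ
    g y x = ne y x * v x y
    regroup : ∀ a b c → a * b * c ≡ a * c * b
    regroup = solve-∀ ℚ-ring
    μ≤g : ∀ e x y → x ≢ y → Joins n e y x → μ P e ≤ g x y
    μ≤g e x y x≢y joins with δ-cases x y
    ... | inj₁ (eq , _) = ⊥-elim (x≢y eq)
    ... | inj₂ (_ , eq) = subst (μ P e ≤_)
      (sym (trans (cong (λ d → (1ℚ - d) * v y x) eq) (*-identityˡ (v y x))))
      (μ≤v e y x (λ y≡x → x≢y (sym y≡x)) joins)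
    perEdge : ∀ e → μ P e * μ P e + μ P e * μ P e ≤
      μ P e * (g (proj₁ (ends n e)) (proj₂ (ends n e)) + g (proj₂ (ends n e)) (proj₁ (ends n e)))
    perEdge e = subst (_≤ μ P e * (g a b + g b a)) (*-distribˡ-+ (μ P e) (μ P e) (μ P e))
      (*-monoˡ (nonneg P e) (+-mono-≤
        (μ≤g e a b (ends-distinct n e) (inj₂ (refl , refl)))
        (μ≤g e b a (λ eq → ends-distinct n e (sym eq)) (inj₁ (refl , refl)))))
      where
      a b : Fin n
      a = proj₁ (ends n e)
      b = proj₂ (ends n e)

  F₁≤2 : F₁ P ≤ + 2 / 1
  F₁≤2 = begin
    (+ 2 / 1) * sumSqSupp P + β P (Path 3)
      ≤⟨ +-monoˡ-≤ (β P (Path 3)) (*-monoˡ (from-yes (0ℚ ≤? + 2 / 1)) sumSqSupp≤) ⟩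
    (+ 2 / 1) * sumSq + β P (Path 3)
      ≡⟨ halve sumSq (β P (Path 3)) ⟩
    ½ * (ι 2 * β P (Path 3) + (sumSq + sumSq)) + sumSq
      ≤⟨ +-mono-≤ (*-monoˡ 0≤½ (≤-trans (+-mono-≤ (2β-path≤ 1) sumSq+sumSq≤) cherries)) sumSq≤1 ⟩
    ½ * 2ℚ + 1ℚ ≡⟨⟩
    + 2 / 1 ∎
    where
    open ≤-Reasoning
    halve : ∀ s b → (+ 2 / 1) * s + b ≡ ½ * ((1ℚ + (1ℚ + 0ℚ)) * b + (s + s)) + s
    halve = solve-∀ ℚ-ring

-- Extremal measures

term≤ΣSubsets : ∀ m {F} → (∀ S → 0ℚ ≤ F S) → ∀ S → F S ≤ ΣSubsets m F
term≤ΣSubsets zero    0≤F []          = ≤-refl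
term≤ΣSubsets (suc m) {F} 0≤F (false ∷ S) =
  ≤-trans (term≤ΣSubsets m (λ S → 0≤F (false ∷ S)) S)
    (≤-by-slack (ΣSubsets m (λ S → F (true ∷ S))) (∑-nonneg (overSubsets m) (λ S → 0≤F (true ∷ S))) refl)
term≤ΣSubsets (suc m) {F} 0≤F (true ∷ S) =
  ≤-trans (term≤ΣSubsets m (λ S → 0≤F (true ∷ S)) S)
    (≤-by-slack (ΣSubsets m (λ S → F (false ∷ S))) (∑-nonneg (overSubsets m) (λ S → 0≤F (false ∷ S)))
      (+-comm (ΣSubsets m (λ S → F (true ∷ S))) (ΣSubsets m (λ S → F (false ∷ S)))))

β-nonneg : ∀ {n} (P : EdgeProb n) H → 0ℚ ≤ β P H
β-nonneg {n} P H = ∑-nonneg (overSubsets (nEdges n)) (λ S → 𝟙-nonneg (isCopy? {n} H S) (weight-nonneg P S))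

weight≤β : ∀ {n} (P : EdgeProb n) H S (f : Vec (Fin n) (verts H)) → Embeds H S f → weight P S ≤ β P H
weight≤β {n} P H S f emb =
  subst (_≤ β P H) (𝟙-yes (isCopy? {n} H S) (f , emb))
    (term≤ΣSubsets (nEdges n) (λ S → 𝟙-nonneg (isCopy? {n} H S) (weight-nonneg P S)) S)

attained : ∀ (F : ∀ {n} → EdgeProb n → ℚ) {c n} (P : EdgeProb n) → c ≤ F P →
  ∀ ε → 0ℚ < ε → ∃ λ n → ∃ λ (P : EdgeProb n) → c - ε < F P
attained F {c} P c≤F ε 0<ε = _ , P ,
  <-≤-trans (subst (c - ε <_) (+-identityʳ c) (+-monoʳ-< c (neg-antimono-< 0<ε))) c≤F

single-edge : EdgeProb 2
single-edge = record { μ = λ _ → 1ℚ ; nonneg = λ _ → 0≤1 ; total = refl }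

triangle : EdgeProb 3
triangle = record { μ = λ _ → ⅓ ; nonneg = λ _ → 0≤⅓ ; total = refl }

quadrangle : EdgeProb 4
quadrangle = record { μ = lookup masses ; nonneg = from-yes (all? (λ e → 0ℚ ≤? lookup masses e)) ; total = refl }
  where
  masses : Vec ℚ 6
  -- The edges of K_4 come in the order 01, 02, 03, 12, 13, 23; the diagonals 02 and 13 get mass 0.
  masses = ¼ ∷ 0ℚ ∷ ¼ ∷ ¼ ∷ 0ℚ ∷ ¼ ∷ []

2≤F₁ : + 2 / 1 ≤ F₁ single-edge
2≤F₁ = ≤-by-slack (β single-edge (Path 3)) (β-nonneg single-edge (Path 3)) refl

-- A single copy suffices for sharpness: with all masses 1/m on an m-cycle it contributes 2m ·
-- m^(-m) = 2/m^(m-1).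
Fm≥ : ∀ m {n} (P : EdgeProb n) S (f : Vec (Fin n) (verts (Cycle m))) → Embeds (Cycle m) S f →
  ∀ {c} → c ≡ (+ (2 ℕ.* m) / 1) * weight P S → c ≤ Fm m P
Fm≥ m P S f emb refl =
  ≤-trans (*-monoˡ (subst (0ℚ ≤_) (ι≡/1 (2 ℕ.* m)) (ι-nonneg (2 ℕ.* m))) (weight≤β P (Cycle m) S f emb))
          (≤-by-slack (β P (Path (suc m))) (β-nonneg P (Path (suc m))) refl)

F₃≥ : over 20 3 ≤ Fm 3 triangle
F₃≥ = Fm≥ 3 triangle S f (from-yes (injective? f ×-dec imageIs? (Cycle 3) f S)) refl
  where
  S : Vec Bool 3
  S = true ∷ true ∷ true ∷ []
  f : Vec (Fin 3) 3
  f = zero ∷ suc zero ∷ suc (suc zero) ∷ []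

F₄≥ : over 20 4 ≤ Fm 4 quadrangle
F₄≥ = Fm≥ 4 quadrangle S f (from-yes (injective? f ×-dec imageIs? (Cycle 4) f S)) refl
  where
  S : Vec Bool 6
  S = true ∷ false ∷ true ∷ true ∷ false ∷ true ∷ []
  f : Vec (Fin 4) 4
  f = zero ∷ suc zero ∷ suc (suc zero) ∷ suc (suc (suc zero)) ∷ []

theorem1p6 : IsSup F₁ (+ 2 / 1)
    × (∀ (m : ℕ) → (m ≡ 3 ⊎ m ≡ 4) → IsSup (Fm m) (over 20 m))
    × (∀ (m : ℕ) → 5 ℕ.≤ m → SupLess (Fm m) (over 27 m))
theorem1p6 =
  ((λ n P → F₁≤2 P) , attained F₁ single-edge 2≤F₁) ,
  -- `κ * Ψ 0 1ℚ` and `over 20 3` both normalise to 2/9.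
  (λ { _ (inj₁ refl) → (λ n P → Fm≤κΨ P 0) , attained (Fm 3) triangle F₃≥
     ; _ (inj₂ refl) → (λ n P → F₄≤ P) , attained (Fm 4) quadrangle F₄≥ }) ,
  (λ { _ (ℕ.s≤s (ℕ.s≤s (ℕ.s≤s (ℕ.s≤s (ℕ.s≤s (ℕ.z≤n {m})))))) →
         κ * Ψ (2 ℕ.+ m) 1ℚ , κΨ<over m , (λ n P → Fm≤κΨ P (2 ℕ.+ m)) })
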